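{- Let $n$ be a positive integer with $n\equiv 6 \pmod{10}$. Then there exists a configuration $(1,5)$ $GDD\left(n,2,6;2n,n-1\right)$.
   Context: A $GDD(n,2,6;\lambda_1,\lambda_2)$ is a finite collection (repetitions allowed) of $6$-element subsets, called blocks, of a $2n$-element set $X$ partitioned into two groups of size $n$, such that every point lies in the same number $r$ of blocks, any two distinct points of the same group lie together in exactly $\lambda_1$ blocks, and any two points from different groups lie together in exactly $\lambda_2$ blocks. It has configuration $(1,5)$ if every block has exactly $1$ point in one of the two groups and $5$ points in the other (which group contains the single point may depend on the block). -}

module Defs where

open import Data.Nat.Base using (ℕ; _*_)
open import Data.Fin.Base using (Fin)
open import Data.Fin.Subset using (Subset; _∈_; _∩_; ∣_∣)
open import Data.Fin.Subset.Properties using (_∈?_)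
open import Data.List.Base using (List; filter; length)
open import Data.List.Relation.Unary.All using (All)
open import Data.Product using (∃!; ∃₂; _×_)
open import Relation.Binary.PropositionalEquality using (_≡_; _≢_)
open import Relation.Nullary.Decidable using (_×-dec_)

module _ {v : ℕ} where

  -- Blocks are counted with multiplicity: a block repeated in the list
  -- counts once per occurrence.

  #blocks∋ : List (Subset v) → Fin v → ℕ
  #blocks∋ blocks x = length (filter (λ B → x ∈? B) blocks)

  #blocks∋₂ : List (Subset v) → Fin v → Fin v → ℕ
  #blocks∋₂ blocks x y =
    length (filter (λ B → (x ∈? B) ×-dec (y ∈? B)) blocks)

-- GDD(n, m, k; λ₁, λ₂): the point set is Fin (m * n), partitioned into m
-- groups of size n.  The partition is part of the data.

record GDD (n m k λ₁ λ₂ : ℕ) : Set where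
  field
    group           : Fin m → Subset (m * n)
    group-partition : ∀ x → ∃! _≡_ (λ i → x ∈ group i)
    group-size      : ∀ i → ∣ group i ∣ ≡ n

    blocks          : List (Subset (m * n))
    block-size      : All (λ B → ∣ B ∣ ≡ k) blocks

    r               : ℕ
    replication     : ∀ x → #blocks∋ blocks x ≡ r

    same-group      : ∀ i {x y} → x ∈ group i → y ∈ group i → x ≢ y →
                      #blocks∋₂ blocks x y ≡ λ₁
    different-group : ∀ {i j} → i ≢ j → ∀ {x y} → x ∈ group i → y ∈ group j →
                      #blocks∋₂ blocks x y ≡ λ₂

-- The groups i and j may depend on the block; with two groups, i ≢ j forces
-- them to be the two groups in one order or the other.

HasConfiguration : ∀ {n k λ₁ λ₂} → ℕ → ℕ → GDD n 2 k λ₁ λ₂ → Set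
HasConfiguration s t D =
  All (λ B → ∃₂ λ i j → i ≢ j × ∣ B ∩ group i ∣ ≡ s × ∣ B ∩ group j ∣ ≡ t) blocks
  where open GDD D

{-# OPTIONS --safe #-}

-- Write n = 5g + 1 with g = 2h + 1, and take each group to be {∞} ∪ (ℤ₅ × ℤ_g).
-- The blocks are the ℤ₅ × ℤ_g-translates of base blocks whose points are
-- (l, c p + d e) with c, d ∈ {−1, 0, 1}, where p runs over 1, …, h and e over {0},
-- over ℤ_g, or over ℤ_g ∖ {0}, together with the ℤ_g-translates of a design for n = 6.
--
-- The number of blocks through (l, a) and (l′, b) is a sum, over pairs of points of
-- base blocks with the right labels, of the number of (p, e) with c p + d e = b − a,
-- where now c, d ∈ {−2, …, 2}.  As 2 is a unit modulo the odd number g, this is h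
-- when d ≠ 0, while for d = 0 ≠ c the equations with c and with −c together have
-- exactly one solution p if b ≠ a, and none otherwise.  So as soon as c and −c occur
-- equally often, the count depends only on whether b = a, and it is a polynomial in h
-- whose coefficients do not depend on h: they are compared by evaluation.

module Submission where

open import Defs
open import Data.Bool.Base using (Bool; true; false; if_then_else_)
import Data.Bool.Properties as Bool
open import Data.Fin.Base as Fin 
  using (Fin; zero; suc; toℕ; fromℕ; fromℕ<; inject₁; opposite; combine; remQuot; _↑ˡ_; _↑ʳ_)
open import Data.Fin.Patterns
import Data.Fin.Properties as Fin
open import Data.Fin.Subset using (Subset; inside; outside; ⊥; ⊤; ⁅_⁆; _∪_; _∩_; ∣_∣; _∈_)
import Data.Fin.Subset.Properties as Sub
open Sub using (_∈?_)
open import Data.Integer.Base as ℤ using (ℤ; 0ℤ; 1ℤ; _%ℕ_; _/ℕ_)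
import Data.Integer.DivMod as ℤ
open import Data.Integer.Divisibility.Signed as ℤ using (_∣_; divides)
import Data.Integer.Properties as ℤ
import Data.Integer.Tactic.RingSolver as ℤSolver
open import Data.List.Base using (List; []; _∷_; _++_; map; concatMap; filter; foldr; length; allFin; tabulate)
import Data.List.Properties as List
open import Data.List.Relation.Unary.All as All using (All; []; _∷_)
import Data.List.Relation.Unary.All.Properties as All
open import Data.List.Relation.Unary.AllPairs as AllPairs using (AllPairs; []; _∷_)
import Data.List.Relation.Unary.AllPairs.Properties as AllPairs
open import Data.List.Relation.Unary.Unique.Propositional using (Unique)
open import Data.Nat.Base as ℕ using (ℕ; zero; suc; _+_; _*_; _∸_; _%_; _/_; _<_; z≤n; s≤s)
import Data.Nat.Divisibility as ℕ
open import Data.Nat.DivMod using (_mod_; m≡m%n+[m/n]*n)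
import Data.Nat.Properties as ℕ
open import Data.Nat.Tactic.RingSolver using (solve-∀)
open import Data.Product using (Σ; _×_; _,_; proj₁; proj₂; ∃; ∃₂)
open import Data.Product.Properties using (≡-dec)
open import Data.Sum.Base using (_⊎_; inj₁; inj₂; [_,_]′)
open import Data.Vec.Base as Vec using (Vec)
import Data.Vec.Properties as Vec
open import Function.Base using (_∘_)
open import Function.Bundles using (_⇔_; mk⇔; Equivalence)
open import Relation.Binary.PropositionalEquality
open import Relation.Nullary.Decidable
  using (Dec; yes; no; does; does-⇔; dec-true; dec-false; toSum; from-yes; ¬?; _×-dec_; _⊎-dec_)
open import Relation.Nullary.Negation using (¬_; contradiction)
open import Relation.Unary using (Decidable)

-- The sizes are forced. Counting pairs through a point gives 5 r = λ₁ (n - 1) + λ₂ n = 3 n (n - 1),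
-- so r = 3 n g, and there are g n² blocks, that is n² up to translation by ℤ_g. The base blocks
-- number 36 + 80 h + 40 g h + 10 (g - 1) h = (6 + 10 h)², as required; the 36 are the design for n
-- = 6.
--
-- That design is a checkerboard: every row and every column of the 6 × 6 array of pairs (p, q) has
-- three cells of each parity. Two points of one side lie in 4 · 3 = 12 common blocks, since p
-- avoids both; points of different sides lie in 2 + 3 = 5.
--
-- The points ∞ are fixed by ℤ_g, so the number of blocks through both is a multiple of g. The value
-- λ₂ = 5 g comes from the design for n = 6 alone; no other base block contains both.

private variable
  A B C : Set
  P Q   : Set
  ν     : ℕ

-- Finite sums and indicators

𝟙 : Dec P → ℕ
𝟙 P? = if does P? then 1 else 0

𝟙-⇔ : P ⇔ Q → (P? : Dec P) (Q? : Dec Q) → 𝟙 P? ≡ 𝟙 Q?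
𝟙-⇔ P⇔Q P? Q? = cong (if_then 1 else 0) (does-⇔ P⇔Q P? Q?)

𝟙-yes : (P? : Dec P) → P → 𝟙 P? ≡ 1
𝟙-yes P? p = cong (if_then 1 else 0) (dec-true P? p)

𝟙-no : (P? : Dec P) → ¬ P → 𝟙 P? ≡ 0
𝟙-no P? ¬p = cong (if_then 1 else 0) (dec-false P? ¬p)

𝟙-× : (P? : Dec P) (Q? : Dec Q) → 𝟙 (P? ×-dec Q?) ≡ 𝟙 P? * 𝟙 Q?
𝟙-× (yes _) Q? = sym (ℕ.*-identityˡ (𝟙 Q?))
𝟙-× (no _)  Q? = refl

∑ : List A → (A → ℕ) → ℕ
∑ []       f = 0
∑ (x ∷ xs) f = f x + ∑ xs f

∑-cong-All : ∀ {xs : List A} {f f′ : A → ℕ} → All (λ x → f x ≡ f′ x) xs → ∑ xs f ≡ ∑ xs f′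
∑-cong-All []       = refl
∑-cong-All (e ∷ es) = cong₂ _+_ e (∑-cong-All es)

∑-cong : ∀ (xs : List A) {f f′ : A → ℕ} → (∀ x → f x ≡ f′ x) → ∑ xs f ≡ ∑ xs f′
∑-cong []       e = refl
∑-cong (x ∷ xs) e = cong₂ _+_ (e x) (∑-cong xs e)

∑-++ : ∀ (xs ys : List A) f → ∑ (xs ++ ys) f ≡ ∑ xs f + ∑ ys f
∑-++ []       ys f = refl
∑-++ (x ∷ xs) ys f = trans (cong (f x +_) (∑-++ xs ys f)) (sym (ℕ.+-assoc (f x) _ _))

∑-map : ∀ (φ : A → B) xs f → ∑ (map φ xs) f ≡ ∑ xs (f ∘ φ)
∑-map φ []       f = refl
∑-map φ (x ∷ xs) f = cong (f (φ x) +_) (∑-map φ xs f)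

∑-concatMap : ∀ (φ : A → List B) xs f → ∑ (concatMap φ xs) f ≡ ∑ xs (λ x → ∑ (φ x) f)
∑-concatMap φ []       f = refl
∑-concatMap φ (x ∷ xs) f = trans (∑-++ (φ x) _ f) (cong (∑ (φ x) f +_) (∑-concatMap φ xs f))

∑-const : ∀ (xs : List A) c → ∑ xs (λ _ → c) ≡ length xs * c
∑-const []       c = refl
∑-const (x ∷ xs) c = cong (c +_) (∑-const xs c)

∑-zero : ∀ (xs : List A) → ∑ xs (λ _ → 0) ≡ 0
∑-zero xs = trans (∑-const xs 0) (ℕ.*-zeroʳ (length xs))

interchange : ∀ a b c d → (a + b) + (c + d) ≡ (a + c) + (b + d)
interchange = solve-∀

∑-+ : ∀ (xs : List A) f f′ → ∑ xs (λ x → f x + f′ x) ≡ ∑ xs f + ∑ xs f′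
∑-+ []       f f′ = refl
∑-+ (x ∷ xs) f f′ = trans (cong (f x + f′ x +_) (∑-+ xs f f′)) (interchange (f x) _ _ _)

∑-*ˡ : ∀ c (xs : List A) f → c * ∑ xs f ≡ ∑ xs (λ x → c * f x)
∑-*ˡ c []       f = ℕ.*-zeroʳ c
∑-*ˡ c (x ∷ xs) f = trans (ℕ.*-distribˡ-+ c (f x) _) (cong (c * f x +_) (∑-*ˡ c xs f))

∑-*ʳ : ∀ c (xs : List A) f → ∑ xs f * c ≡ ∑ xs (λ x → f x * c)
∑-*ʳ c xs f = trans (ℕ.*-comm _ c) (trans (∑-*ˡ c xs f) (∑-cong xs λ x → ℕ.*-comm c (f x)))

∑-swap : ∀ (xs : List A) (ys : List B) (f : A → B → ℕ) →
         ∑ xs (λ x → ∑ ys (f x)) ≡ ∑ ys (λ y → ∑ xs (λ x → f x y))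
∑-swap []       ys f = sym (∑-zero ys)
∑-swap (x ∷ xs) ys f = trans (cong (∑ ys (f x) +_) (∑-swap xs ys f)) (sym (∑-+ ys (f x) _))

∑-product : ∀ (xs : List A) (ys : List B) f f′ →
            ∑ xs f * ∑ ys f′ ≡ ∑ xs (λ x → ∑ ys (λ y → f x * f′ y))
∑-product xs ys f f′ = trans (∑-*ʳ (∑ ys f′) xs f) (∑-cong xs λ x → ∑-*ˡ (f x) ys f′)

length-filter : ∀ {P : A → Set} (P? : Decidable P) xs → length (filter P? xs) ≡ ∑ xs (𝟙 ∘ P?)
length-filter P? []       = refl
length-filter P? (x ∷ xs) with does (P? x)
... | true  = cong suc (length-filter P? xs)
... | false = length-filter P? xs

∑-tabulate : ∀ {n} (φ : Fin n → A) f → ∑ (tabulate φ) f ≡ ∑ (allFin n) (f ∘ φ)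
∑-tabulate {n = zero}  φ f = refl
∑-tabulate {n = suc n} φ f = cong (f (φ zero) +_)
  (trans (∑-tabulate (φ ∘ suc) f) (sym (∑-tabulate suc (f ∘ φ))))

∑-allFin-suc : ∀ {n} (f : Fin (suc n) → ℕ) → ∑ (allFin (suc n)) f ≡ f zero + ∑ (allFin n) (f ∘ suc)
∑-allFin-suc f = cong (f zero +_) (∑-tabulate suc f)

∑-allFin-const : ∀ n c → ∑ (allFin n) (λ _ → c) ≡ n * c
∑-allFin-const zero    c = refl
∑-allFin-const (suc n) c = trans (∑-allFin-suc {n} (λ _ → c)) (cong (c +_) (∑-allFin-const n c))

∑-allFin-+ : ∀ m n (f : Fin (m + n) → ℕ) →
             ∑ (allFin (m + n)) f ≡ ∑ (allFin m) (λ i → f (i ↑ˡ n)) + ∑ (allFin n) (λ j → f (m ↑ʳ j))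
∑-allFin-+ zero    n f = refl
∑-allFin-+ (suc m) n f = begin
  ∑ (allFin (suc m + n)) f                                       ≡⟨ ∑-allFin-suc f ⟩
  f zero + ∑ (allFin (m + n)) (f ∘ suc)                          ≡⟨ cong (f zero +_) (∑-allFin-+ m n (f ∘ suc)) ⟩
  f zero + (∑ (allFin m) (λ i → f (suc (i ↑ˡ n))) + R)           ≡⟨ ℕ.+-assoc (f zero) _ R ⟨
  f zero + ∑ (allFin m) (λ i → f (suc (i ↑ˡ n))) + R             ≡⟨ cong (_+ R) (∑-allFin-suc (λ i → f (i ↑ˡ n))) ⟨
  ∑ (allFin (suc m)) (λ i → f (i ↑ˡ n)) + R                      ∎
  where
  open ≡-Reasoning
  R = ∑ (allFin n) (λ j → f (suc (m ↑ʳ j)))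

∑-allFin-last : ∀ n (f : Fin (suc n) → ℕ) → ∑ (allFin (suc n)) f ≡ ∑ (allFin n) (f ∘ inject₁) + f (fromℕ n)
∑-allFin-last zero    f = ℕ.+-identityʳ (f zero)
∑-allFin-last (suc n) f = begin
  ∑ (allFin (suc (suc n))) f                                       ≡⟨ ∑-allFin-suc f ⟩
  f zero + ∑ (allFin (suc n)) (f ∘ suc)
    ≡⟨ cong (f zero +_) (∑-allFin-last n (f ∘ suc)) ⟩
  f zero + (∑ (allFin n) (f ∘ suc ∘ inject₁) + f (fromℕ (suc n)))  ≡⟨ ℕ.+-assoc (f zero) _ _ ⟨
  f zero + ∑ (allFin n) (f ∘ suc ∘ inject₁) + f (fromℕ (suc n))
    ≡⟨ cong (_+ f (fromℕ (suc n))) (∑-allFin-suc (f ∘ inject₁)) ⟨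
  ∑ (allFin (suc n)) (f ∘ inject₁) + f (fromℕ (suc n))             ∎
  where open ≡-Reasoning

∑-allFin-opposite : ∀ n (f : Fin n → ℕ) → ∑ (allFin n) (f ∘ opposite) ≡ ∑ (allFin n) f
∑-allFin-opposite zero    f = refl
∑-allFin-opposite (suc n) f = begin
  ∑ (allFin (suc n)) (f ∘ opposite)                      ≡⟨ ∑-allFin-suc (f ∘ opposite) ⟩
  f (fromℕ n) + ∑ (allFin n) (f ∘ inject₁ ∘ opposite)
    ≡⟨ cong (f (fromℕ n) +_) (∑-allFin-opposite n (f ∘ inject₁)) ⟩
  f (fromℕ n) + ∑ (allFin n) (f ∘ inject₁)               ≡⟨ ℕ.+-comm (f (fromℕ n)) _ ⟩
  ∑ (allFin n) (f ∘ inject₁) + f (fromℕ n)               ≡⟨ ∑-allFin-last n f ⟨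
  ∑ (allFin (suc n)) f                                   ∎
  where open ≡-Reasoning

∑-δ : ∀ {n} (c : Fin n) (f : Fin n → ℕ) → ∑ (allFin n) (λ x → 𝟙 (x Fin.≟ c) * f x) ≡ f c
∑-δ {suc n} zero    f = begin
  ∑ (allFin (suc n)) (λ x → 𝟙 (x Fin.≟ zero) * f x)  ≡⟨ ∑-allFin-suc (λ x → 𝟙 (x Fin.≟ zero) * f x) ⟩
  f zero + 0 + ∑ (allFin n) (λ _ → 0)                ≡⟨ cong₂ _+_ (ℕ.+-identityʳ (f zero)) (∑-zero (allFin n)) ⟩
  f zero + 0                                         ≡⟨ ℕ.+-identityʳ (f zero) ⟩
  f zero                                             ∎
  where open ≡-Reasoning
∑-δ {suc n} (suc c) f = trans (∑-allFin-suc (λ x → 𝟙 (x Fin.≟ suc c) * f x)) (∑-δ c (f ∘ suc))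

-- Grouping equal entries separates multiplicities from values: this later splits a count into a
-- tally of atoms, free of h, and their weights, which carry h.
∑-occurrences : ∀ {n} (xs : List (Fin n)) (f : Fin n → ℕ) →
                ∑ xs f ≡ ∑ (allFin n) (λ b → ∑ xs (λ x → 𝟙 (b Fin.≟ x)) * f b)
∑-occurrences {n} xs f = begin
  ∑ xs f                                                      ≡⟨ ∑-cong xs (λ x → ∑-δ x f) ⟨
  ∑ xs (λ x → ∑ (allFin n) (λ b → 𝟙 (b Fin.≟ x) * f b))       ≡⟨ ∑-swap xs (allFin n) _ ⟩
  ∑ (allFin n) (λ b → ∑ xs (λ x → 𝟙 (b Fin.≟ x) * f b))       ≡⟨ ∑-cong (allFin n) (λ b → ∑-*ʳ (f b) xs _) ⟨
  ∑ (allFin n) (λ b → ∑ xs (λ x → 𝟙 (b Fin.≟ x)) * f b)       ∎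
  where open ≡-Reasoning

∑-swap₂ : ∀ (xs : List A) (ys : List B) (zs : List C) (f : A → B → C → ℕ) →
          ∑ xs (λ x → ∑ ys (λ y → ∑ zs (f x y))) ≡ ∑ ys (λ y → ∑ zs (λ z → ∑ xs (λ x → f x y z)))
∑-swap₂ xs ys zs f = trans (∑-swap xs ys (λ x y → ∑ zs (f x y))) (∑-cong ys (λ y → ∑-swap xs zs (λ x → f x y)))

∑-filter : ∀ {P : A → Set} (P? : Decidable P) xs f →
           ∑ (filter P? xs) f ≡ ∑ xs (λ x → 𝟙 (P? x) * f x)
∑-filter P? []       f = refl
∑-filter P? (x ∷ xs) f with does (P? x)
... | true  = cong₂ _+_ (sym (ℕ.+-identityʳ (f x))) (∑-filter P? xs f)
... | false = ∑-filter P? xs f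

concatMap⁺ : ∀ {P : B → Set} {φ : A → List B} {xs} → All (λ x → All P (φ x)) xs → All P (concatMap φ xs)
concatMap⁺ = All.concat⁺ ∘ All.map⁺

-- Subsets of Fin ν

fromPoints : List (Fin ν) → Subset ν
fromPoints = foldr (λ x S → ⁅ x ⁆ ∪ S) ⊥

multiplicity : Fin ν → List (Fin ν) → ℕ
multiplicity x L = ∑ L (λ u → 𝟙 (x Fin.≟ u))

-- Without repetitions the multiplicity of a point is 0 or 1. Membership thereby becomes a sum over
-- the points of a block, which can be interchanged with sums over parameters and translates.
∈-fromPoints : ∀ {L : List (Fin ν)} → Unique L → ∀ x → 𝟙 (x ∈? fromPoints L) ≡ multiplicity x L
∈-fromPoints []                  x = 𝟙-no (x ∈? ⊥) Sub.∉⊥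
∈-fromPoints {L = y ∷ L} (y∉L ∷ uL) x with x Fin.≟ y
... | yes refl = trans (𝟙-yes (y ∈? fromPoints (y ∷ L)) (Sub.x∈p∪q⁺ (inj₁ (Sub.x∈⁅x⁆ y))))
                   (cong suc (sym (trans (∑-cong-All (All.map (𝟙-no (y Fin.≟ _)) y∉L)) (∑-zero L))))
... | no x≢y   = trans (𝟙-⇔ (mk⇔ strip (Sub.x∈p∪q⁺ ∘ inj₂)) (x ∈? fromPoints (y ∷ L)) (x ∈? fromPoints L))
                   (∈-fromPoints uL x)
  where
  strip : x ∈ ⁅ y ⁆ ∪ fromPoints L → x ∈ fromPoints L
  strip x∈ with Sub.x∈p∪q⁻ ⁅ y ⁆ (fromPoints L) x∈
  ... | inj₁ x∈y = contradiction (Sub.x∈⁅y⁆⇒x≡y y x∈y) x≢y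
  ... | inj₂ x∈L = x∈L

∣∣-∑ : (p : Subset ν) → ∣ p ∣ ≡ ∑ (allFin ν) (λ x → 𝟙 (x ∈? p))
∣∣-∑ {zero}  Vec.[]            = refl
∣∣-∑ {suc ν} (b Vec.∷ p) = trans (head b) (trans
  (cong (λ k → 𝟙 (zero ∈? b Vec.∷ p) + k) (trans (∣∣-∑ p) (∑-cong (allFin ν) λ x →
    𝟙-⇔ (mk⇔ Vec.there Sub.drop-there) (x ∈? p) (suc x ∈? b Vec.∷ p))))
  (sym (∑-allFin-suc (λ x → 𝟙 (x ∈? b Vec.∷ p)))))
  where
  head : ∀ b → ∣ b Vec.∷ p ∣ ≡ 𝟙 (zero ∈? b Vec.∷ p) + ∣ p ∣
  head inside  = refl
  head outside = refl

-- Serves twice: with `⊤` for the block size, and with a group for the configuration.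
∣fromPoints-∩∣ : ∀ {L : List (Fin ν)} → Unique L → ∀ q → ∣ fromPoints L ∩ q ∣ ≡ ∑ L (λ u → 𝟙 (u ∈? q))
∣fromPoints-∩∣ {ν} {L} uL q = begin
  ∣ fromPoints L ∩ q ∣                                                 ≡⟨ ∣∣-∑ (fromPoints L ∩ q) ⟩
  ∑ (allFin ν) (λ x → 𝟙 (x ∈? fromPoints L ∩ q))                       ≡⟨ ∑-cong (allFin ν) split ⟩
  ∑ (allFin ν) (λ x → ∑ L (λ u → 𝟙 (x Fin.≟ u) * 𝟙 (x ∈? q)))          ≡⟨ ∑-swap (allFin ν) L _ ⟩
  ∑ L (λ u → ∑ (allFin ν) (λ x → 𝟙 (x Fin.≟ u) * 𝟙 (x ∈? q)))
    ≡⟨ ∑-cong L (λ u → ∑-δ u (λ x → 𝟙 (x ∈? q))) ⟩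
  ∑ L (λ u → 𝟙 (u ∈? q))                                               ∎
  where
  open ≡-Reasoning
  split : ∀ x → 𝟙 (x ∈? fromPoints L ∩ q) ≡ ∑ L (λ u → 𝟙 (x Fin.≟ u) * 𝟙 (x ∈? q))
  split x = begin
    𝟙 (x ∈? fromPoints L ∩ q)
      ≡⟨ 𝟙-⇔ (mk⇔ (Sub.x∈p∩q⁻ _ _) Sub.x∈p∩q⁺) (x ∈? fromPoints L ∩ q) (x ∈? fromPoints L ×-dec x ∈? q) ⟩
    𝟙 (x ∈? fromPoints L ×-dec x ∈? q)            ≡⟨ 𝟙-× (x ∈? fromPoints L) (x ∈? q) ⟩
    𝟙 (x ∈? fromPoints L) * 𝟙 (x ∈? q)            ≡⟨ cong (_* 𝟙 (x ∈? q)) (∈-fromPoints uL x) ⟩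
    multiplicity x L * 𝟙 (x ∈? q)                 ≡⟨ ∑-*ʳ (𝟙 (x ∈? q)) L _ ⟩
    ∑ L (λ u → 𝟙 (x Fin.≟ u) * 𝟙 (x ∈? q))        ∎

∣fromPoints∣ : ∀ {L : List (Fin ν)} → Unique L → ∣ fromPoints L ∣ ≡ length L
∣fromPoints∣ {ν} {L} uL = begin
  ∣ fromPoints L ∣           ≡⟨ cong ∣_∣ (Sub.∩-identityʳ (fromPoints L)) ⟨
  ∣ fromPoints L ∩ ⊤ ∣       ≡⟨ ∣fromPoints-∩∣ uL ⊤ ⟩
  ∑ L (λ u → 𝟙 (u ∈? ⊤))     ≡⟨ ∑-cong L (λ u → 𝟙-yes (u ∈? ⊤) Sub.∈⊤) ⟩
  ∑ L (λ _ → 1)              ≡⟨ ∑-const L 1 ⟩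
  length L * 1               ≡⟨ ℕ.*-identityʳ (length L) ⟩
  length L                   ∎
  where open ≡-Reasoning

-- The partition of the point set into groups of equal size

∑-combine : ∀ m n (f : Fin (m * n) → ℕ) →
            ∑ (allFin (m * n)) f ≡ ∑ (allFin m) (λ i → ∑ (allFin n) (f ∘ combine i))
∑-combine zero    n f = refl
∑-combine (suc m) n f = begin
  ∑ (allFin (n + m * n)) f
    ≡⟨ ∑-allFin-+ n (m * n) f ⟩
  ∑ (allFin n) (λ j → f (j ↑ˡ m * n)) + ∑ (allFin (m * n)) (λ k → f (n ↑ʳ k))
    ≡⟨ cong (∑ (allFin n) (λ j → f (j ↑ˡ m * n)) +_) (∑-combine m n (λ k → f (n ↑ʳ k))) ⟩
  ∑ (allFin n) (f ∘ combine {suc m} zero) + ∑ (allFin m) (λ i → ∑ (allFin n) (f ∘ combine (suc i)))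
    ≡⟨ ∑-allFin-suc {m} (λ i → ∑ (allFin n) (f ∘ combine i)) ⟨
  ∑ (allFin (suc m)) (λ i → ∑ (allFin n) (f ∘ combine i)) ∎
  where open ≡-Reasoning

module _ {m : ℕ} (n : ℕ) where

  part : Fin (m * n) → Fin m
  part x = proj₁ (remQuot n x)

  parts : Fin m → Subset (m * n)
  parts i = Vec.tabulate (λ x → does (part x Fin.≟ i))

  ∈-parts : ∀ x i → x ∈ parts i ⇔ part x ≡ i
  ∈-parts x i = mk⇔ to from
    where
    to : x ∈ parts i → part x ≡ i
    to x∈ with part x Fin.≟ i | trans (sym (Vec.lookup∘tabulate _ x)) (Vec.[]=⇒lookup x∈)
    ... | yes e | _ = e
    from : part x ≡ i → x ∈ parts i
    from e = Vec.lookup⇒[]= x (parts i) (trans (Vec.lookup∘tabulate _ x) (does-true e))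
      where
      does-true : part x ≡ i → does (part x Fin.≟ i) ≡ true
      does-true e with part x Fin.≟ i
      ... | yes _ = refl
      ... | no ¬e = contradiction e ¬e

  𝟙-parts : ∀ x i → 𝟙 (x ∈? parts i) ≡ 𝟙 (part x Fin.≟ i)
  𝟙-parts x i = 𝟙-⇔ (∈-parts x i) (x ∈? parts i) (part x Fin.≟ i)

  part-combine : ∀ i j → part (combine i j) ≡ i
  part-combine i j = cong proj₁ (Fin.remQuot-combine i j)

  ∣parts∣ : ∀ i → ∣ parts i ∣ ≡ n
  ∣parts∣ i = begin
    ∣ parts i ∣                                                          ≡⟨ ∣∣-∑ (parts i) ⟩
    ∑ (allFin (m * n)) (λ x → 𝟙 (x ∈? parts i))
      ≡⟨ ∑-cong (allFin (m * n)) (λ x → 𝟙-parts x i) ⟩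
    ∑ (allFin (m * n)) (λ x → 𝟙 (part x Fin.≟ i))                        ≡⟨ ∑-combine m n _ ⟩
    ∑ (allFin m) (λ k → ∑ (allFin n) (λ j → 𝟙 (part (combine k j) Fin.≟ i)))  ≡⟨ ∑-cong (allFin m) row ⟩
    ∑ (allFin m) (λ k → 𝟙 (k Fin.≟ i) * n)                               ≡⟨ ∑-δ i (λ _ → n) ⟩
    n                                                                    ∎
    where
    open ≡-Reasoning
    row : ∀ k → ∑ (allFin n) (λ j → 𝟙 (part (combine k j) Fin.≟ i)) ≡ 𝟙 (k Fin.≟ i) * n
    row k = trans (∑-cong (allFin n) (λ j → cong (λ l → 𝟙 (l Fin.≟ i)) (part-combine k j)))
                  (trans (∑-allFin-const n _) (ℕ.*-comm n _))

-- Base blocks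

data Trit : Set where
  ⊖ ⊙ ⊕ : Trit

flip : Trit → Trit
flip ⊖ = ⊕
flip ⊙ = ⊙
flip ⊕ = ⊖

-- Differences of coefficients stay symbolic, so that `atom` can classify them by matching before h
-- is chosen.
data Pent : Set where
  -2# -1# 0# 1# 2# : Pent

_⊝_ : Trit → Trit → Pent
⊖ ⊝ ⊖ = 0#
⊖ ⊝ ⊙ = -1#
⊖ ⊝ ⊕ = -2#
⊙ ⊝ ⊖ = 1#
⊙ ⊝ ⊙ = 0#
⊙ ⊝ ⊕ = -1#
⊕ ⊝ ⊖ = 2#
⊕ ⊝ ⊙ = 1#
⊕ ⊝ ⊕ = 0#

-- The side (group) and the label; the label 0 stands for ∞, and suc l for l ∈ ℤ₅.
Orbit : Set
Orbit = Fin 2 × Fin 6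

_≟ₒ_ : (o o′ : Orbit) → Dec (o ≡ o′)
_≟ₒ_ = ≡-dec Fin._≟_ Fin._≟_

-- The point with label l and residue cᵖ p + cᵉ e, or ∞, for which cᵖ and cᵉ are junk.
record Desc : Set where
  constructor desc
  field
    orbit : Orbit
    cᵖ cᵉ : Trit

open Desc public

Template : Set
Template = List Desc

-- The ranges {(0, 0)}, {1, …, h} × {0} and {1, …, h} × ℤ_g of the parameters (p, e).
data Dom : Set where
  one half full : Dom

pattern ∞ = 0F

at : Fin 2 → Fin 5 → Trit → Trit → Desc
at s l = desc (s , suc l)

at∞ : Fin 2 → Desc
at∞ s = desc (s , ∞) ⊙ ⊙

rotate : Fin 5 → Desc → Desc
rotate i (desc (s , ∞)     c d) = desc (s , ∞) c d
rotate i (desc (s , suc l) c d) = desc (s , suc ((toℕ l + toℕ i) mod 5)) c d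

rotations : Template → List Template
rotations t = map (λ i → map (rotate i) t) (allFin 5)

module _ (s : Fin 2) where
  private t = Fin.opposite s

  pairsAndPoint : Fin 5 → Trit → Template
  pairsAndPoint j ε =
    at s 1F ⊕ ⊙ ∷ at s 1F ⊖ ⊙ ∷ at s 0F ⊙ ⊙ ∷ at s 4F ⊕ ⊕ ∷ at s 4F ⊖ ⊕ ∷ at t j ⊙ ε ∷ []

  -- pairsAndPoint at e = 0, with its point of label 0 moved to ∞.
  pairsAnd∞ : Fin 5 → Template
  pairsAnd∞ j =
    at s 1F ⊕ ⊙ ∷ at s 1F ⊖ ⊙ ∷ at∞ s ∷ at s 4F ⊕ ⊙ ∷ at s 4F ⊖ ⊙ ∷ at t j ⊙ ⊙ ∷ []

  pairsAgainst∞ : Template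
  pairsAgainst∞ =
    at s 1F ⊕ ⊙ ∷ at s 1F ⊖ ⊙ ∷ at s 2F ⊕ ⊙ ∷ at s 2F ⊖ ⊙ ∷ at s 0F ⊙ ⊙ ∷ at∞ t ∷ []

  -- In `pairsAndPoint` the labels 0 and 1 have coefficient differences c = ±1, d = 0, so they never
  -- meet in equal residues. The adjacent labels with equal signs here (0 and 1, 2 and 3), and 0 and
  -- 1 in `transversal∞`, help to make up this deficit, while labels at distance 2 always have
  -- different signs.
  transversal : Fin 5 → Trit → Template
  transversal j ε =
    at s 0F (flip ε) ⊙ ∷ at s 1F (flip ε) ⊙ ∷ at s 2F ε ⊙ ∷ at s 3F ε ⊙ ∷ at s 4F ⊙ ⊙ ∷ at t j ⊙ ⊙ ∷ []

  transversal∞ : Fin 5 → Trit → Template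
  transversal∞ j ε =
    at s 0F ⊙ ⊙ ∷ at s 1F ⊙ ⊙ ∷ at s 2F ε ⊙ ∷ at s 4F (flip ε) ⊙ ∷ at∞ s ∷ at t j ε ⊙ ∷ []

-- The special templates are used with e ≠ 0 only: at e = 0 they are replaced by
-- pairsAnd∞.  The label of the point on the other side of each template, and its sign,
-- are chosen so that the two sides complement each other in every count for λ₂.
special : Fin 2 → Template
special 0F = pairsAndPoint 0F 2F ⊕
special 1F = pairsAndPoint 1F 3F ⊖

-- Within one label on one side, the five templates with e free would each contain two pairs ±p and
-- yield 10 g per nonzero difference. Dropping e = 0 from the special one loses 2, which `pairsAnd∞`
-- restores, and `pairsAgainst∞` adds 2, for 10 g + 2 = 2 n in all. Five templates per side join ∞
-- to four points of its own side, which accounts for 20 h of 2 n = 12 + 20 h. The transversals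
-- occur with both signs because one alone has c without -c.
regular : Fin 2 → List (Dom × Template)
regular 0F =
  (full , pairsAndPoint 0F 0F ⊕) ∷ (full , pairsAndPoint 0F 1F ⊕) ∷
  (full , pairsAndPoint 0F 3F ⊖) ∷ (full , pairsAndPoint 0F 4F ⊖) ∷
  (half , pairsAnd∞ 0F 2F) ∷ (half , pairsAgainst∞ 0F) ∷
  (half , transversal 0F 2F ⊕) ∷ (half , transversal 0F 2F ⊖) ∷
  (half , transversal∞ 0F 3F ⊕) ∷ (half , transversal∞ 0F 3F ⊖) ∷
  (half , transversal∞ 0F 4F ⊕) ∷ (half , transversal∞ 0F 4F ⊖) ∷ []
regular 1F =
  (full , pairsAndPoint 1F 0F ⊕) ∷ (full , pairsAndPoint 1F 1F ⊕) ∷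
  (full , pairsAndPoint 1F 2F ⊖) ∷ (full , pairsAndPoint 1F 4F ⊖) ∷
  (half , pairsAnd∞ 1F 3F) ∷ (half , pairsAgainst∞ 1F) ∷
  (half , transversal 1F 0F ⊕) ∷ (half , transversal 1F 0F ⊖) ∷
  (half , transversal∞ 1F 4F ⊕) ∷ (half , transversal∞ 1F 4F ⊖) ∷
  (half , transversal∞ 1F 0F ⊕) ∷ (half , transversal∞ 1F 0F ⊖) ∷ []

-- The blocks of a design for n = 6: for each p on one side and q on the other, either
-- q joins the five points other than p, or p joins the five points other than q.
sixPoint : Fin 6 → Fin 6 → Template
sixPoint p q = if (toℕ p + toℕ q) % 2 ℕ.≡ᵇ 0
  then still 1F q ∷ map (still 0F) (filter (λ l → ¬? (l Fin.≟ p)) (allFin 6))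
  else still 0F p ∷ map (still 1F) (filter (λ l → ¬? (l Fin.≟ q)) (allFin 6))
  where
  still : Fin 2 → Fin 6 → Desc
  still s q = desc (s , q) ⊙ ⊙

ordinary : List (Dom × Template)
ordinary =
  concatMap (λ p → map (λ q → one , sixPoint p q) (allFin 6)) (allFin 6) ++
  concatMap (λ s → concatMap (λ (D , t) → map (D ,_) (rotations t)) (regular s)) (allFin 2)

specials : List Template
specials = concatMap (rotations ∘ special) (allFin 2)

-- The counts are uniform for the full range of e, so the design is handled as the
-- difference of virtual, where e = 0 is allowed throughout, and extra.
virtual extra : List (Dom × Template)
virtual = ordinary ++ map (full ,_) specials
extra   = map (half ,_) specials

-- The possible numbers of solutions (p, e) of c p + d e = δ, in the order of weightVector.
Atom : Set
Atom = Fin 12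

pattern 10F = suc 9F
pattern 11F = suc 10F

-- The coefficient of e comes first so that, once it is nonzero, the value reduces with the
-- coefficient of p still a variable.
fullAtom : (e p : Pent) → Atom
fullAtom 0# 0#  = 3F
fullAtom 0# -1# = 8F
fullAtom 0# 1#  = 9F
fullAtom 0# -2# = 10F
fullAtom 0# 2#  = 11F
fullAtom _  _   = 0F

atom : Dom → (p e : Pent) → Atom
atom one  _   _ = 1F
atom half 0#  _ = 2F
atom half -1# _ = 4F
atom half 1#  _ = 5F
atom half -2# _ = 6F
atom half 2#  _ = 7F
atom full p   e = fullAtom e p

-- A pair involving ∞ puts no condition on (p, e), so it receives the trivial equation 0 p + 0 e =
-- 0. Its atoms are among `1F`, `2F`, `3F`, which `generic` ignores.
atomOf : Fin 6 → Fin 6 → Dom → Desc → Desc → Atom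
atomOf (suc _) (suc _) D k l = atom D (cᵖ l ⊝ cᵖ k) (cᵉ l ⊝ cᵉ k)
atomOf ∞       _       D k l = atom D 0# 0#
atomOf (suc _) ∞       D k l = atom D 0# 0#

on : Orbit → Template → List Desc
on o = filter (λ d → orbit d ≟ₒ o)

atoms : Orbit → Orbit → List (Dom × Template) → List Atom
atoms o o′ = concatMap (λ (D , t) →
  concatMap (λ k → map (atomOf (proj₂ o) (proj₂ o′) D k) (on o′ t)) (on o t))

tally : List Atom → Vec ℕ 12
tally as = Vec.tabulate (λ b → ∑ as (λ a → 𝟙 (b Fin.≟ a)))

-- Coefficients of 1, h and g h.
Poly : Set
Poly = Vec ℕ 3

poly : ℕ → ℕ → ℕ → Poly
poly a b c = a Vec.∷ b Vec.∷ c Vec.∷ Vec.[]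

infixl 6 _⊞_
_⊞_ : Poly → Poly → Poly
_⊞_ = Vec.zipWith _+_

Balanced : Vec ℕ 12 → Set
Balanced v = n 4F ≡ n 5F × n 6F ≡ n 7F × n 8F ≡ n 9F × n 10F ≡ n 11F
  where n = Vec.lookup v

balanced? : ∀ v → Dec (Balanced v)
balanced? v = (_ ℕ.≟ _) ×-dec (_ ℕ.≟ _) ×-dec (_ ℕ.≟ _) ×-dec (_ ℕ.≟ _)

-- The weight of a balanced tally for residues that differ and for residues that agree;
-- 8F to 11F count with weight g = 1 + 2 h.
generic coincident : Vec ℕ 12 → Poly
generic v = poly (n 4F + n 6F) (n 0F) 0 ⊞ poly (n 8F + n 10F) (2 * (n 8F + n 10F)) 0
  where n = Vec.lookup v
coincident v = poly (n 1F) (n 0F + n 2F) (n 3F)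
  where n = Vec.lookup v

-- 12 + 20 h = 2 n and 5 + 10 h = n ∸ 1; the replication number is 18 + 36 h + 30 g h,
-- and counts between two points ∞ are divided by g.
genericTarget coincidentTarget : Orbit → Orbit → Poly
genericTarget (_ , ∞) _       = poly 0 0 0
genericTarget _       (_ , ∞) = poly 0 0 0
genericTarget (s , _) (s′ , _) = if does (s Fin.≟ s′) then poly 12 20 0 else poly 5 10 0
coincidentTarget (s , ∞) (s′ , ∞) = if does (s Fin.≟ s′) then poly 18 30 0 else poly 5 0 0
coincidentTarget (s , q) (s′ , q′) = if does (s Fin.≟ s′)
  then (if does (q Fin.≟ q′) then poly 18 36 30 else poly 12 20 0)
  else poly 5 10 0

-- The finite check over all pairs of orbits

Certified : Orbit → Orbit → Vec ℕ 12 → Vec ℕ 12 → Set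
Certified o o′ n m = Balanced n × Balanced m ×
  generic n ≡ generic m ⊞ genericTarget o o′ × coincident n ≡ coincident m ⊞ coincidentTarget o o′

certified? : ∀ o o′ n m → Dec (Certified o o′ n m)
certified? o o′ n m = balanced? n ×-dec balanced? m ×-dec (_ ≟ _) ×-dec (_ ≟ _)
  where
  _≟_ : (x y : Poly) → Dec (x ≡ y)
  _≟_ = Vec.≡-dec ℕ._≟_

abstract
  -- There are 144 ordered pairs of orbits and h does not occur, so one evaluation serves every n.
  -- Being `abstract`, it is not unfolded again where it is used.
  certificate : ∀ s q s′ q′ → let o = s , q; o′ = s′ , q′ in
                Certified o o′ (tally (atoms o o′ virtual)) (tally (atoms o o′ extra))
  certificate = from-yes (Fin.all? λ s → Fin.all? λ q → Fin.all? λ s′ → Fin.all? λ q′ →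
    certified? (s , q) (s′ , q′) (tally (atoms (s , q) (s′ , q′) virtual)) (tally (atoms (s , q) (s′ , q′) extra)))

-- Distinct points and the (1,5) shape of base blocks

nonzero : Pent → Bool
nonzero 0# = false
nonzero _  = true

constant : Dom → Bool
constant one = true
constant _   = false

-- A decidable condition, free of h, for two points to differ at every parameter. The second case is
-- for the pairs of opposite sign in one label; it excludes the domain `one`, where p = 0.
Apart : Dom → Desc → Desc → Set
Apart D k l = orbit k ≢ orbit l ⊎
  proj₂ (orbit k) ≢ ∞ × constant D ≡ false × nonzero (cᵖ l ⊝ cᵖ k) ≡ true × nonzero (cᵉ l ⊝ cᵉ k) ≡ false

#side : Template → Fin 2 → ℕ
#side t i = ∑ t (λ d → 𝟙 (proj₁ (orbit d) Fin.≟ i))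

Shape : Template → Set
Shape t = length t ≡ 6 × ∃ λ i → #side t i ≡ 1 × #side t (Fin.opposite i) ≡ 5

WellFormed : Dom × Template → Set
WellFormed (D , t) = AllPairs (Apart D) t × Shape t

apart? : ∀ D k l → Dec (Apart D k l)
apart? D k l = ¬? (orbit k ≟ₒ orbit l) ⊎-dec
  (¬? (proj₂ (orbit k) Fin.≟ ∞) ×-dec (_ Bool.≟ _) ×-dec (_ Bool.≟ _) ×-dec (_ Bool.≟ _))

shape? : ∀ t → Dec (Shape t)
shape? t = (length t ℕ.≟ 6) ×-dec Fin.any? λ i → (#side t i ℕ.≟ 1) ×-dec (#side t (Fin.opposite i) ℕ.≟ 5)

abstract
  -- In `virtual` the special templates have domain `full`. Distinctness rests on p ≠ 0 and holds
  -- for any e, so it carries over to the range without e = 0.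
  wellFormed : All WellFormed virtual
  wellFormed = from-yes (All.all? (λ (D , t) → AllPairs.allPairs? (apart? D) t ×-dec shape? t) virtual)

module Construction (h : ℕ) where
  open import Data.Integer.Base using (+_)

  g : ℕ
  g = suc (h + h)

  -- Residues modulo g

  infix 4 _≈_ _≈?_

  _≈_ : ℤ → ℤ → Set
  a ≈ b = + g ∣ a ℤ.- b

  _≈?_ : ∀ a b → Dec (a ≈ b)
  a ≈? b = + g ℤ.∣? a ℤ.- b

  -- Most congruence arguments below take this form: a ring identity exhibits the difference in
  -- question as a combination of multiples of g.
  ∣-resp : ∀ {a b} c d → a ≡ c ℤ.* b ℤ.+ d → + g ∣ b → + g ∣ d → + g ∣ a
  ∣-resp c d e g∣b g∣d = subst (+ g ∣_) (sym e) (ℤ.∣m∣n⇒∣m+n (ℤ.∣n⇒∣m*n c g∣b) g∣d)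

  ≈-reflexive : ∀ {a b} → a ≡ b → a ≈ b
  ≈-reflexive {a} refl = divides (+ 0) (ℤ.+-inverseʳ a)

  ≈-sym : ∀ {a b} → a ≈ b → b ≈ a
  ≈-sym {a} {b} a≈b = ∣-resp (ℤ.- + 1) (+ 0) (lemma a b) a≈b (divides (+ 0) refl)
    where
    lemma : ∀ a b → b ℤ.- a ≡ (ℤ.- + 1) ℤ.* (a ℤ.- b) ℤ.+ + 0
    lemma = ℤSolver.solve-∀

  ≈-trans : ∀ {a b c} → a ≈ b → b ≈ c → a ≈ c
  ≈-trans {a} {b} {c} a≈b b≈c = ∣-resp (+ 1) (b ℤ.- c) (lemma a b c) a≈b b≈c
    where
    lemma : ∀ a b c → a ℤ.- c ≡ + 1 ℤ.* (a ℤ.- b) ℤ.+ (b ℤ.- c)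
    lemma = ℤSolver.solve-∀

  congruent : ∀ a b z → a ≈ b → a ≈ z ⇔ b ≈ z
  congruent a b z a≈b = mk⇔ (≈-trans {b} {a} {z} (≈-sym {a} {b} a≈b)) (≈-trans {a} {b} {z} a≈b)

  π : ℤ → Fin g
  π z = fromℕ< (ℤ.n%ℕd<d z g)

  ι : Fin g → ℤ
  ι = +_ ∘ toℕ

  ι-π : ∀ z → ι (π z) ≈ z
  ι-π z = divides (ℤ.- (z /ℕ g)) (begin
    ι (π z) ℤ.- z                                ≡⟨ cong (λ r → + r ℤ.- z) (Fin.toℕ-fromℕ< (ℤ.n%ℕd<d z g)) ⟩
    + (z %ℕ g) ℤ.- z                             ≡⟨ cong (λ y → + (z %ℕ g) ℤ.- y) (ℤ.a≡a%ℕn+[a/ℕn]*n z g) ⟩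
    + (z %ℕ g) ℤ.- (+ (z %ℕ g) ℤ.+ z /ℕ g ℤ.* + g)  ≡⟨ lemma (+ (z %ℕ g)) (z /ℕ g) (+ g) ⟩
    ℤ.- (z /ℕ g) ℤ.* + g                         ∎)
    where
    open ≡-Reasoning
    lemma : ∀ r q m → r ℤ.- (r ℤ.+ q ℤ.* m) ≡ ℤ.- q ℤ.* m
    lemma = ℤSolver.solve-∀

  ≤∧≈⇒≡ : ∀ {a b} → a ℕ.≤ b → b ℕ.< g → + b ≈ + a → a ≡ b
  ≤∧≈⇒≡ {a} {b} a≤b b<g b≈a = ℕ.≤-antisym a≤b (ℕ.m∸n≡0⇒m≤n b∸a≡0)
    where
    g∣b∸a : g ℕ.∣ b ∸ a
    g∣b∸a = subst (g ℕ.∣_) (trans (cong ℤ.∣_∣ (ℤ.[+m]-[+n]≡m⊖n b a)) (cong ℤ.∣_∣ (ℤ.⊖-≥ a≤b))) (ℤ.∣⇒∣ᵤ b≈a)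
    b∸a≡0 : b ∸ a ≡ 0
    b∸a≡0 with b ∸ a in eq
    ... | zero  = refl
    ... | suc k = contradiction (ℕ.∣⇒≤ (subst (g ℕ.∣_) eq g∣b∸a))
                    (ℕ.<⇒≱ (subst (ℕ._< g) eq (ℕ.≤-<-trans (ℕ.m∸n≤m b a) b<g)))

  ι-injective : ∀ {a b} → ι a ≈ ι b → a ≡ b
  ι-injective {a} {b} a≈b with ℕ.≤-total (toℕ a) (toℕ b)
  ... | inj₁ a≤b = Fin.toℕ-injective (≤∧≈⇒≡ a≤b (Fin.toℕ<n b) (≈-sym {ι a} {ι b} a≈b))
  ... | inj₂ b≤a = sym (Fin.toℕ-injective (≤∧≈⇒≡ b≤a (Fin.toℕ<n a) a≈b))

  ι≈⇔≡π : ∀ a z → ι a ≈ z ⇔ a ≡ π z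
  ι≈⇔≡π a z = mk⇔
    (λ a≈z → ι-injective (≈-trans {ι a} {z} {ι (π z)} a≈z (≈-sym {ι (π z)} {z} (ι-π z))))
    (λ { refl → ι-π z })

  ∑-residue : ∀ z f → ∑ (allFin g) (λ x → 𝟙 (ι x ≈? z) * f x) ≡ f (π z)
  ∑-residue z f = trans
    (∑-cong (allFin g) (λ x → cong (_* f x) (𝟙-⇔ (ι≈⇔≡π x z) (ι x ≈? z) (x Fin.≟ π z))))
    (∑-δ (π z) f)

  ∑-residue-1 : ∀ z → ∑ (allFin g) (λ x → 𝟙 (ι x ≈? z)) ≡ 1
  ∑-residue-1 z = trans (∑-cong (allFin g) (λ x → sym (ℕ.*-identityʳ _))) (∑-residue z (λ _ → 1))

  record Unit (c : ℤ) : Set where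
    constructor unit
    field
      inv   : ℤ
      c*inv : c ℤ.* inv ≈ + 1

  open Unit

  -- Each direction multiplies the given difference by `c′` or `c` and corrects by a multiple of
  -- `c * c′ − 1`, which g divides.
  solve-unit : ∀ {c} (u : Unit c) δ e d → δ ≈ c ℤ.* e ℤ.+ d ⇔ e ≈ inv u ℤ.* (δ ℤ.- d)
  solve-unit {c} (unit c′ cc′) δ e d = mk⇔
    (λ ∣₁ → ∣-resp (ℤ.- c′) _ (to c c′ δ e d) ∣₁ (ℤ.∣n⇒∣m*n (ℤ.- e) cc′))
    (λ ∣₁ → ∣-resp (ℤ.- c) _ (from c c′ δ e d) ∣₁ (ℤ.∣n⇒∣m*n (ℤ.- (δ ℤ.- d)) cc′))
    where
    to : ∀ c c′ δ e d → e ℤ.- c′ ℤ.* (δ ℤ.- d) ≡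
         ℤ.- c′ ℤ.* (δ ℤ.- (c ℤ.* e ℤ.+ d)) ℤ.+ ℤ.- e ℤ.* (c ℤ.* c′ ℤ.- + 1)
    to = ℤSolver.solve-∀
    from : ∀ c c′ δ e d → δ ℤ.- (c ℤ.* e ℤ.+ d) ≡
           ℤ.- c ℤ.* (e ℤ.- c′ ℤ.* (δ ℤ.- d)) ℤ.+ ℤ.- (δ ℤ.- d) ℤ.* (c ℤ.* c′ ℤ.- + 1)
    from = ℤSolver.solve-∀

  unit-1 : Unit (+ 1)
  unit-1 = unit (+ 1) (divides (+ 0) refl)

  unit-2 : Unit (+ 2)
  -- 2 (h + 1) = g + 1.
  unit-2 = unit (+ suc h) (divides (+ 1) (begin
    + 2 ℤ.* + suc h ℤ.- + 1                ≡⟨ cong (λ z → + 2 ℤ.* z ℤ.- + 1) (ℤ.pos-+ 1 h) ⟩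
    + 2 ℤ.* (+ 1 ℤ.+ + h) ℤ.- + 1          ≡⟨ lemma (+ h) ⟩
    + 1 ℤ.* (+ 1 ℤ.+ (+ h ℤ.+ + h))        ≡⟨ cong (λ z → + 1 ℤ.* (+ 1 ℤ.+ z)) (ℤ.pos-+ h h) ⟨
    + 1 ℤ.* (+ 1 ℤ.+ + (h + h))            ≡⟨ cong (λ y → + 1 ℤ.* y) (ℤ.pos-+ 1 (h + h)) ⟨
    + 1 ℤ.* + g                            ∎))
    where
    open ≡-Reasoning
    lemma : ∀ h → + 2 ℤ.* (+ 1 ℤ.+ h) ℤ.- + 1 ≡ + 1 ℤ.* (+ 1 ℤ.+ (h ℤ.+ h))
    lemma = ℤSolver.solve-∀

  unit-neg : ∀ {c} → Unit c → Unit (ℤ.- c)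
  unit-neg {c} (unit c′ cc′) = unit (ℤ.- c′) (subst (_≈ + 1) (lemma c c′) cc′)
    where
    lemma : ∀ c c′ → c ℤ.* c′ ≡ ℤ.- c ℤ.* ℤ.- c′
    lemma = ℤSolver.solve-∀

  ∑-linear : ∀ {c} → Unit c → ∀ δ d → ∑ (allFin g) (λ e → 𝟙 (δ ≈? c ℤ.* ι e ℤ.+ d)) ≡ 1
  ∑-linear {c} u δ d = trans
    (∑-cong (allFin g) (λ e → 𝟙-⇔ (solve-unit u δ (ι e) d) (δ ≈? c ℤ.* ι e ℤ.+ d) (ι e ≈? e₀)))
    (∑-residue-1 e₀)
    where e₀ = inv u ℤ.* (δ ℤ.- d)

  pos : Fin h → ℤ
  pos k = + suc (toℕ k)

  -- The integers 0, ±1, ..., ±h form a complete system of residues modulo g = 2 h + 1.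
  ∑-balanced : ∀ z → ∑ (allFin h) (λ k → 𝟙 (pos k ≈? z)) + ∑ (allFin h) (λ k → 𝟙 (ℤ.- pos k ≈? z)) +
                     𝟙 (+ 0 ≈? z) ≡ 1
  ∑-balanced z = begin
    S⁺ + S⁻ + 𝟙 (+ 0 ≈? z)                             ≡⟨ ℕ.+-comm (S⁺ + S⁻) _ ⟩
    𝟙 (+ 0 ≈? z) + (S⁺ + S⁻)                           ≡⟨ cong (λ m → 𝟙 (+ 0 ≈? z) + m) (cong₂ _+_ left right) ⟨
    𝟙 (+ 0 ≈? z) + (∑ (allFin h) (λ k → f (suc (k ↑ˡ h))) + ∑ (allFin h) (λ k → f (suc (h ↑ʳ k))))
                                                     ≡⟨ cong (λ m → 𝟙 (+ 0 ≈? z) + m) (∑-allFin-+ h h (f ∘ suc)) ⟨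
    𝟙 (+ 0 ≈? z) + ∑ (allFin (h + h)) (f ∘ suc)      ≡⟨ ∑-allFin-suc f ⟨
    ∑ (allFin g) f                                   ≡⟨ ∑-residue-1 z ⟩
    1                                                ∎
    where
    open ≡-Reasoning
    S⁺ = ∑ (allFin h) (λ k → 𝟙 (pos k ≈? z))
    S⁻ = ∑ (allFin h) (λ k → 𝟙 (ℤ.- pos k ≈? z))
    f : Fin g → ℕ
    f x = 𝟙 (ι x ≈? z)
    left : ∑ (allFin h) (λ k → f (suc (k ↑ˡ h))) ≡ S⁺
    left = ∑-cong (allFin h) (λ k → cong (λ m → 𝟙 (+ suc m ≈? z)) (Fin.toℕ-↑ˡ k h))
    -- Reversing the upper half h + 1, ..., 2 h of the residues puts g - (k + 1) in position k.
    reflected : ∀ k → ι (suc (h ↑ʳ opposite k)) ≈ ℤ.- pos k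
    reflected k = divides (+ 1) (begin
      + suc (toℕ (h ↑ʳ opposite k)) ℤ.- (ℤ.- pos k)
        ≡⟨ cong (λ y → + suc (toℕ (h ↑ʳ opposite k)) ℤ.+ y) (ℤ.neg-involutive (pos k)) ⟩
      + (suc (toℕ (h ↑ʳ opposite k)) + suc (toℕ k))
        ≡⟨ cong (λ m → + (suc m + suc (toℕ k))) (trans (Fin.toℕ-↑ʳ h (opposite k)) (cong (λ m → h + m) (Fin.opposite-prop k))) ⟩
      + (suc (h + (h ∸ suc (toℕ k))) + suc (toℕ k))   ≡⟨ cong (λ m → + suc m) (ℕ.+-assoc h _ _) ⟩
      + suc (h + (h ∸ suc (toℕ k) + suc (toℕ k)))     ≡⟨ cong (λ m → + suc (h + m)) (ℕ.m∸n+n≡m (Fin.toℕ<n k)) ⟩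
      + g                                             ≡⟨ ℤ.*-identityˡ (+ g) ⟨
      + 1 ℤ.* + g                                     ∎)
    right : ∑ (allFin h) (λ k → f (suc (h ↑ʳ k))) ≡ S⁻
    right = trans (sym (∑-allFin-opposite h (λ k → f (suc (h ↑ʳ k)))))
      (∑-cong (allFin h) (λ k → 𝟙-⇔ (congruent (ι (suc (h ↑ʳ opposite k))) (ℤ.- pos k) z (reflected k))
        (ι (suc (h ↑ʳ opposite k)) ≈? z) (ℤ.- pos k ≈? z)))

  -- Numbers of parameters solving a linear equation

  Param : Set
  Param = ℤ × ℤ

  rectangle : List (Fin g) → List Param
  rectangle = concatMap (λ e → map (λ k → pos k , ι e) (allFin h))

  dom : Dom → List Param
  dom one  = (+ 0 , + 0) ∷ []
  dom half = rectangle (zero ∷ [])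
  dom full = rectangle (allFin g)

  punctured : List Param
  punctured = rectangle (tabulate suc)

  ∑-rectangle : ∀ es f → ∑ (rectangle es) f ≡ ∑ es (λ e → ∑ (allFin h) (λ k → f (pos k , ι e)))
  ∑-rectangle es f = trans (∑-concatMap _ es f) (∑-cong es (λ e → ∑-map _ (allFin h) f))

  ⟦_⟧ᵗ : Trit → ℤ
  ⟦ ⊖ ⟧ᵗ = ℤ.- + 1
  ⟦ ⊙ ⟧ᵗ = + 0
  ⟦ ⊕ ⟧ᵗ = + 1

  ⟦_⟧ : Pent → ℤ
  ⟦ -2# ⟧ = ℤ.- + 2
  ⟦ -1# ⟧ = ℤ.- + 1
  ⟦ 0#  ⟧ = + 0
  ⟦ 1#  ⟧ = + 1
  ⟦ 2#  ⟧ = + 2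

  ⟦⊝⟧ : ∀ a b → ⟦ a ⊝ b ⟧ ≡ ⟦ a ⟧ᵗ ℤ.- ⟦ b ⟧ᵗ
  ⟦⊝⟧ ⊖ ⊖ = refl
  ⟦⊝⟧ ⊖ ⊙ = refl
  ⟦⊝⟧ ⊖ ⊕ = refl
  ⟦⊝⟧ ⊙ ⊖ = refl
  ⟦⊝⟧ ⊙ ⊙ = refl
  ⟦⊝⟧ ⊙ ⊕ = refl
  ⟦⊝⟧ ⊕ ⊖ = refl
  ⟦⊝⟧ ⊕ ⊙ = refl
  ⟦⊝⟧ ⊕ ⊕ = refl

  form : Desc → Param → ℤ
  form d (p , e) = ⟦ cᵖ d ⟧ᵗ ℤ.* p ℤ.+ ⟦ cᵉ d ⟧ᵗ ℤ.* e

  form-⊝ : ∀ k l p e → form l (p , e) ℤ.- form k (p , e) ≡ ⟦ cᵖ l ⊝ cᵖ k ⟧ ℤ.* p ℤ.+ ⟦ cᵉ l ⊝ cᵉ k ⟧ ℤ.* e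
  form-⊝ k l p e rewrite ⟦⊝⟧ (cᵖ l) (cᵖ k) | ⟦⊝⟧ (cᵉ l) (cᵉ k) =
    lemma ⟦ cᵖ l ⟧ᵗ ⟦ cᵉ l ⟧ᵗ ⟦ cᵖ k ⟧ᵗ ⟦ cᵉ k ⟧ᵗ p e
    where
    lemma : ∀ a b c d p e → (a ℤ.* p ℤ.+ b ℤ.* e) ℤ.- (c ℤ.* p ℤ.+ d ℤ.* e) ≡
                            (a ℤ.- c) ℤ.* p ℤ.+ (b ℤ.- d) ℤ.* e
    lemma = ℤSolver.solve-∀

  -- Weights of atoms at a given difference of residues

  ζ : ℤ → ℕ
  ζ δ = 𝟙 (δ ≈? + 0)

  η : ℤ → ℤ → ℕ
  η δ c = ∑ (allFin h) (λ k → 𝟙 (δ ≈? c ℤ.* pos k ℤ.+ + 0))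

  -- The five counts are arguments so that the evaluations of `dot` below can treat them as
  -- variables, knowing only the relations among them.
  weightVector : (ζ η₋₁ η₁ η₋₂ η₂ : ℕ) → Vec ℕ 12
  weightVector ζ η₋₁ η₁ η₋₂ η₂ =
    h Vec.∷ ζ Vec.∷ h * ζ Vec.∷ g * (h * ζ) Vec.∷
    η₋₁ Vec.∷ η₁ Vec.∷ η₋₂ Vec.∷ η₂ Vec.∷
    g * η₋₁ Vec.∷ g * η₁ Vec.∷ g * η₋₂ Vec.∷ g * η₂ Vec.∷ Vec.[]

  weights : ℤ → Vec ℕ 12
  weights δ = weightVector (ζ δ) (η δ ⟦ -1# ⟧) (η δ ⟦ 1# ⟧) (η δ ⟦ -2# ⟧) (η δ ⟦ 2# ⟧)

  weight : ℤ → Atom → ℕ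
  weight δ = Vec.lookup (weights δ)

  -- Division by the unit c turns the three conditions into p = z, -p = z and 0 = z for one residue
  -- z, so `∑-balanced` applies.
  η-opposite : ∀ {c} → Unit c → ∀ δ → η δ (ℤ.- c) + η δ c + ζ δ ≡ 1
  η-opposite {c} u δ = begin
    η δ (ℤ.- c) + η δ c + ζ δ
      ≡⟨ cong₂ _+_ (trans (ℕ.+-comm (η δ (ℤ.- c)) _) (cong₂ _+_ (shift pos) negative)) zeroTerm ⟩
    ∑ (allFin h) (λ k → 𝟙 (pos k ≈? z)) + ∑ (allFin h) (λ k → 𝟙 (ℤ.- pos k ≈? z)) + 𝟙 (+ 0 ≈? z)
                                 ≡⟨ ∑-balanced z ⟩
    1                            ∎
    where
    open ≡-Reasoning
    z = Unit.inv u ℤ.* (δ ℤ.- + 0)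
    shift : ∀ (f : Fin h → ℤ) → ∑ (allFin h) (λ k → 𝟙 (δ ≈? c ℤ.* f k ℤ.+ + 0)) ≡ ∑ (allFin h) (λ k → 𝟙 (f k ≈? z))
    shift f = ∑-cong (allFin h) (λ k → 𝟙-⇔ (solve-unit u δ (f k) (+ 0)) (δ ≈? c ℤ.* f k ℤ.+ + 0) (f k ≈? z))
    negative : η δ (ℤ.- c) ≡ ∑ (allFin h) (λ k → 𝟙 (ℤ.- pos k ≈? z))
    negative = trans (∑-cong (allFin h) (λ k → cong (λ y → 𝟙 (δ ≈? y ℤ.+ + 0)) (move c (pos k)))) (shift (ℤ.-_ ∘ pos))
      where
      move : ∀ c p → ℤ.- c ℤ.* p ≡ c ℤ.* (ℤ.- p)
      move = ℤSolver.solve-∀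
    zeroTerm : ζ δ ≡ 𝟙 (+ 0 ≈? z)
    zeroTerm = trans (cong (λ y → 𝟙 (δ ≈? y)) (sym (trans (ℤ.+-identityʳ _) (ℤ.*-zeroʳ c))))
                     (𝟙-⇔ (solve-unit u δ (+ 0) (+ 0)) (δ ≈? c ℤ.* + 0 ℤ.+ + 0) (+ 0 ≈? z))

  η-zero : ∀ δ → η δ (+ 0) ≡ h * ζ δ
  η-zero δ = trans (∑-cong (allFin h) (λ k → cong (λ y → 𝟙 (δ ≈? y)) (ℤ.+-identityʳ (+ 0 ℤ.* pos k))))
    (trans (∑-cong (allFin h) (λ k → cong (λ y → 𝟙 (δ ≈? y)) (ℤ.*-zeroˡ (pos k)))) (∑-allFin-const h (ζ δ)))

  row : ∀ c δ {y} → y ≡ + 0 → ∑ (allFin h) (λ k → 𝟙 (δ ≈? c ℤ.* pos k ℤ.+ y)) ≡ η δ c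
  row c δ refl = refl

  ∑-half : ∀ c d δ → ∑ (dom half) (λ (p , e) → 𝟙 (δ ≈? c ℤ.* p ℤ.+ d ℤ.* e)) ≡ η δ c
  ∑-half c d δ = trans (∑-rectangle (zero ∷ []) _) (trans (ℕ.+-identityʳ _) (row c δ (ℤ.*-zeroʳ d)))

  ∑-full-zero : ∀ c δ → ∑ (dom full) (λ (p , e) → 𝟙 (δ ≈? c ℤ.* p ℤ.+ + 0 ℤ.* e)) ≡ g * η δ c
  ∑-full-zero c δ = trans (∑-rectangle (allFin g) _)
    (trans (∑-cong (allFin g) (λ e → row c δ (ℤ.*-zeroˡ (ι e)))) (∑-allFin-const g (η δ c)))

  -- For each p there is exactly one e, because its coefficient is a unit; hence the interchange of
  -- the two sums.
  ∑-full-unit : ∀ c {d} → Unit d → ∀ δ → ∑ (dom full) (λ (p , e) → 𝟙 (δ ≈? c ℤ.* p ℤ.+ d ℤ.* e)) ≡ h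
  ∑-full-unit c {d} u δ = begin
    ∑ (dom full) _                                        ≡⟨ ∑-rectangle (allFin g) _ ⟩
    ∑ (allFin g) (λ e → ∑ (allFin h) (λ k → F k e))       ≡⟨ ∑-swap (allFin g) (allFin h) (λ e k → F k e) ⟩
    ∑ (allFin h) (λ k → ∑ (allFin g) (F k))               ≡⟨ ∑-cong (allFin h) (λ k → trans
                                                               (∑-cong (allFin g) (λ e → cong (λ y → 𝟙 (δ ≈? y)) (ℤ.+-comm (c ℤ.* pos k) _)))
                                                               (∑-linear u δ (c ℤ.* pos k))) ⟩
    ∑ (allFin h) (λ _ → 1)                                ≡⟨ ∑-allFin-const h 1 ⟩
    h * 1                                                 ≡⟨ ℕ.*-identityʳ h ⟩
    h                                                     ∎
    where
    open ≡-Reasoning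
    F : Fin h → Fin g → ℕ
    F k e = 𝟙 (δ ≈? c ℤ.* pos k ℤ.+ d ℤ.* ι e)

  ∑-weight : ∀ D c d δ → ∑ (dom D) (λ (p , e) → 𝟙 (δ ≈? ⟦ c ⟧ ℤ.* p ℤ.+ ⟦ d ⟧ ℤ.* e)) ≡ weight δ (atom D c d)
  ∑-weight one  c   d   δ = trans (ℕ.+-identityʳ _)
    (cong (λ y → 𝟙 (δ ≈? y)) (cong₂ ℤ._+_ (ℤ.*-zeroʳ ⟦ c ⟧) (ℤ.*-zeroʳ ⟦ d ⟧)))
  ∑-weight half 0#  d   δ = trans (∑-half (+ 0) ⟦ d ⟧ δ) (η-zero δ)
  ∑-weight half -1# d   δ = ∑-half ⟦ -1# ⟧ ⟦ d ⟧ δ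
  ∑-weight half 1#  d   δ = ∑-half ⟦ 1# ⟧ ⟦ d ⟧ δ
  ∑-weight half -2# d   δ = ∑-half ⟦ -2# ⟧ ⟦ d ⟧ δ
  ∑-weight half 2#  d   δ = ∑-half ⟦ 2# ⟧ ⟦ d ⟧ δ
  ∑-weight full 0#  0#  δ = trans (∑-full-zero (+ 0) δ) (cong (g *_) (η-zero δ))
  ∑-weight full -1# 0#  δ = ∑-full-zero ⟦ -1# ⟧ δ
  ∑-weight full 1#  0#  δ = ∑-full-zero ⟦ 1# ⟧ δ
  ∑-weight full -2# 0#  δ = ∑-full-zero ⟦ -2# ⟧ δ
  ∑-weight full 2#  0#  δ = ∑-full-zero ⟦ 2# ⟧ δ
  ∑-weight full c -2# δ = ∑-full-unit ⟦ c ⟧ (unit-neg unit-2) δ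
  ∑-weight full c -1# δ = ∑-full-unit ⟦ c ⟧ (unit-neg unit-1) δ
  ∑-weight full c 1#  δ = ∑-full-unit ⟦ c ⟧ unit-1 δ
  ∑-weight full c 2#  δ = ∑-full-unit ⟦ c ⟧ unit-2 δ

  -- Evaluation of tallies as polynomials in h

  ⟪_⟫ : Poly → ℕ
  ⟪ a Vec.∷ b Vec.∷ c Vec.∷ Vec.[] ⟫ = a + b * h + c * (g * h)

  ⟪⟫-⊞ : ∀ x y → ⟪ x ⊞ y ⟫ ≡ ⟪ x ⟫ + ⟪ y ⟫
  ⟪⟫-⊞ (a Vec.∷ b Vec.∷ c Vec.∷ Vec.[]) (a′ Vec.∷ b′ Vec.∷ c′ Vec.∷ Vec.[]) = lemma a b c a′ b′ c′ h (g * h)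
    where
    lemma : ∀ a b c a′ b′ c′ x y → (a + a′) + (b + b′) * x + (c + c′) * y ≡
                                   (a + b * x + c * y) + (a′ + b′ * x + c′ * y)
    lemma = solve-∀

  dot : ∀ {k} → Vec ℕ k → Vec ℕ k → ℕ
  dot Vec.[]       Vec.[]       = 0
  dot (n Vec.∷ ns) (w Vec.∷ ws) = n * w + dot ns ws

  ∑-dot : ∀ {k} (f : Fin k → ℕ) w → ∑ (allFin k) (λ b → f b * Vec.lookup w b) ≡ dot (Vec.tabulate f) w
  ∑-dot {zero}  f Vec.[]      = refl
  ∑-dot {suc k} f (x Vec.∷ w) = trans (∑-allFin-suc {k} (λ b → f b * Vec.lookup (x Vec.∷ w) b))
    (cong (λ y → f zero * x + y) (∑-dot (f ∘ suc) w))

  ∑-tally : ∀ as δ → ∑ as (weight δ) ≡ dot (tally as) (weights δ)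
  ∑-tally as δ = trans (∑-occurrences as (weight δ)) (∑-dot (λ b → ∑ as (λ a → 𝟙 (b Fin.≟ a))) (weights δ))

  drop-zero : ∀ m {y R R′} → y ≡ 0 → R ≡ R′ → m * y + R ≡ R′
  drop-zero m refl R≡ = cong₂ _+_ (ℕ.*-zeroʳ m) R≡

  merge-pair : ∀ m {x y R R′} → x + y + 0 ≡ 1 → R ≡ R′ → m * x + (m * y + R) ≡ m + R′
  merge-pair m {x} {y} {R} {R′} x+y refl = begin
    m * x + (m * y + R)    ≡⟨ collect m x y R ⟩
    m * (x + y + 0) + R    ≡⟨ cong (λ s → m * s + R) x+y ⟩
    m * 1 + R              ≡⟨ cong (λ k → k + R) (ℕ.*-identityʳ m) ⟩
    m + R                  ∎
    where
    open ≡-Reasoning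
    collect : ∀ m x y R → m * x + (m * y + R) ≡ m * (x + y + 0) + R
    collect = solve-∀

  merge-pair-g : ∀ m {x y R R′} → x + y + 0 ≡ 1 → R ≡ R′ → m * (g * x) + (m * (g * y) + R) ≡ m * g + R′
  merge-pair-g m {x} {y} {R} x+y R≡ = trans
    (cong₂ (λ a b → a + (b + R)) (sym (ℕ.*-assoc m g x)) (sym (ℕ.*-assoc m g y)))
    (merge-pair (m * g) x+y R≡)

  -- Balance gives c and -c a common multiplicity m, and their weights add up to 1, or to g for the
  -- full range: each pair contributes m or m g.
  dot-apart : ∀ v {ζ x y z w} → Balanced v → ζ ≡ 0 → x + y + ζ ≡ 1 → z + w + ζ ≡ 1 →
              dot v (weightVector ζ x y z w) ≡ ⟪ generic v ⟫
  dot-apart (n₀ Vec.∷ n₁ Vec.∷ n₂ Vec.∷ n₃ Vec.∷ n₄ Vec.∷ _ Vec.∷ n₆ Vec.∷ _ Vec.∷ n₈ Vec.∷ _ Vec.∷ n₁₀ Vec.∷ _ Vec.∷ Vec.[])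
    (refl , refl , refl , refl) refl x+y z+w = trans
    (cong (λ R → n₀ * h + R)
      (drop-zero n₁ refl (drop-zero n₂ (ℕ.*-zeroʳ h) (drop-zero n₃ (trans (cong (g *_) (ℕ.*-zeroʳ h)) (ℕ.*-zeroʳ g))
        (merge-pair n₄ x+y (merge-pair n₆ z+w (merge-pair-g n₈ x+y (merge-pair-g n₁₀ z+w refl))))))))
    (expand n₀ n₄ n₆ n₈ n₁₀ h)
    where
    expand : ∀ n₀ n₄ n₆ n₈ n₁₀ h → n₀ * h + (n₄ + (n₆ + (n₈ * (1 + (h + h)) + (n₁₀ * (1 + (h + h)) + 0)))) ≡
      (n₄ + n₆ + (n₈ + n₁₀)) + (n₀ + 2 * (n₈ + n₁₀)) * h + 0 * ((1 + (h + h)) * h)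
    expand = solve-∀

  -- When the residues agree, `ζ` already exhausts the sum 1, so all counts with c ≠ 0 vanish.
  dot-met : ∀ v {ζ x y z w} → ζ ≡ 1 → x + y + ζ ≡ 1 → z + w + ζ ≡ 1 →
            dot v (weightVector ζ x y z w) ≡ ⟪ coincident v ⟫
  dot-met (n₀ Vec.∷ n₁ Vec.∷ n₂ Vec.∷ n₃ Vec.∷ n₄ Vec.∷ n₅ Vec.∷ n₆ Vec.∷ n₇ Vec.∷ n₈ Vec.∷ n₉ Vec.∷ n₁₀ Vec.∷ n₁₁ Vec.∷ Vec.[])
    {x = x} {y} {z} {w} refl x+y z+w = trans
    (cong (λ R → n₀ * h + (n₁ * 1 + (n₂ * (h * 1) + (n₃ * (g * (h * 1)) + R))))
      (drop-zero n₄ x≡0 (drop-zero n₅ y≡0 (drop-zero n₆ z≡0 (drop-zero n₇ w≡0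
      (drop-zero n₈ (g*0 x≡0) (drop-zero n₉ (g*0 y≡0) (drop-zero n₁₀ (g*0 z≡0) (drop-zero n₁₁ (g*0 w≡0) refl)))))))))
    (expand n₀ n₁ n₂ n₃ h g)
    where
    x+y≡0 : x + y ≡ 0
    x+y≡0 = ℕ.+-cancelʳ-≡ 1 (x + y) 0 x+y
    z+w≡0 : z + w ≡ 0
    z+w≡0 = ℕ.+-cancelʳ-≡ 1 (z + w) 0 z+w
    x≡0 : x ≡ 0
    x≡0 = ℕ.m+n≡0⇒m≡0 x x+y≡0
    y≡0 : y ≡ 0
    y≡0 = ℕ.m+n≡0⇒n≡0 x x+y≡0
    z≡0 : z ≡ 0
    z≡0 = ℕ.m+n≡0⇒m≡0 z z+w≡0
    w≡0 : w ≡ 0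
    w≡0 = ℕ.m+n≡0⇒n≡0 z z+w≡0
    g*0 : ∀ {y} → y ≡ 0 → g * y ≡ 0
    g*0 refl = ℕ.*-zeroʳ g
    expand : ∀ n₀ n₁ n₂ n₃ h g → n₀ * h + (n₁ * 1 + (n₂ * (h * 1) + (n₃ * (g * (h * 1)) + 0))) ≡
      n₁ + (n₀ + n₂) * h + n₃ * (g * h)
    expand = solve-∀

  dot-generic : ∀ v δ → Balanced v → ¬ δ ≈ + 0 → dot v (weights δ) ≡ ⟪ generic v ⟫
  dot-generic v δ balanced δ≉0 = dot-apart v balanced (𝟙-no (δ ≈? + 0) δ≉0) (η-opposite unit-1 δ) (η-opposite unit-2 δ)

  dot-coincident : ∀ v δ → δ ≈ + 0 → dot v (weights δ) ≡ ⟪ coincident v ⟫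
  dot-coincident v δ δ≈0 = dot-met v (𝟙-yes (δ ≈? + 0) δ≈0) (η-opposite unit-1 δ) (η-opposite unit-2 δ)

  -- Points and blocks

  n V : ℕ
  n = suc (5 * g)
  V = 2 * n

  point : Orbit → Fin g → Fin V
  point (s , ∞)     a = combine {2} {n} s zero
  point (s , suc l) a = combine {2} {n} s (suc (combine {5} {g} l a))

  point-surjective : ∀ x → ∃₂ λ o a → point o a ≡ x
  point-surjective x with Fin.combine-surjective {2} {n} x
  ... | s , zero  , refl = (s , ∞) , zero , refl
  ... | s , suc y , refl with Fin.combine-surjective {5} {g} y
  ...   | l , a , refl = (s , suc l) , a , refl

  part-point : ∀ o a → part {2} n (point o a) ≡ proj₁ o
  part-point (s , ∞)     a = part-combine {2} n s zero
  part-point (s , suc l) a = part-combine {2} n s (suc (combine {5} {g} l a))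

  -- Translation fixes ∞, so no congruence arises there.
  incident : Fin 6 → Fin g → ℤ → ℕ
  incident ∞       a z = 1
  incident (suc _) a z = 𝟙 (ι a ≈? z)

  point-orbit : ∀ o o′ {a b} → point o a ≡ point o′ b → o ≡ o′
  point-orbit (s , ∞)     (s′ , ∞)      e with refl ← Fin.combine-injectiveˡ {2} {n} s zero s′ zero e = refl
  point-orbit (s , ∞)     (s′ , suc l′) e with () ← Fin.combine-injectiveʳ {2} {n} s zero s′ (suc _) e
  point-orbit (s , suc l) (s′ , ∞)      e with () ← Fin.combine-injectiveʳ {2} {n} s (suc _) s′ zero e
  point-orbit (s , suc l) (s′ , suc l′) {a} {b} e
    with refl , e′ ← Fin.combine-injective {2} {n} s (suc (combine {5} {g} l a)) s′ (suc (combine {5} {g} l′ b)) e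
    with refl ← Fin.combine-injectiveˡ {5} {g} l a l′ b (Fin.suc-injective e′) = refl

  point-residue : ∀ s l {a b} → point (s , suc l) a ≡ point (s , suc l) b → a ≡ b
  point-residue s l {a} {b} e = Fin.combine-injectiveʳ {5} {g} l a l b
    (Fin.suc-injective (Fin.combine-injectiveʳ {2} {n} s (suc (combine {5} {g} l a)) s (suc (combine {5} {g} l b)) e))

  𝟙-point : ∀ o a o′ z → 𝟙 (point o a Fin.≟ point o′ (π z)) ≡ 𝟙 (o′ ≟ₒ o) * incident (proj₂ o) a z
  𝟙-point o a o′ z with o′ ≟ₒ o
  ... | no o′≢o = 𝟙-no (point o a Fin.≟ point o′ (π z)) (λ e → o′≢o (sym (point-orbit o o′ e)))
  𝟙-point (s , ∞)     a .(s , ∞)     z | yes refl = 𝟙-yes (point (s , ∞) a Fin.≟ point (s , ∞) (π z)) refl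
  𝟙-point (s , suc l) a .(s , suc l) z | yes refl = trans
    (𝟙-⇔ (mk⇔ (Equivalence.from (ι≈⇔≡π a z) ∘ point-residue s l)
               (cong (point (s , suc l)) ∘ Equivalence.to (ι≈⇔≡π a z)))
         (point (s , suc l) a Fin.≟ point (s , suc l) (π z)) (ι a ≈? z))
    (sym (ℕ.*-identityˡ _))

  position : ℤ → Param → Desc → Fin V
  position x pe d = point (orbit d) (π (x ℤ.+ form d pe))

  -- The first congruence determines the translate x; eliminating it from the second leaves a
  -- condition on the difference of the residues only.
  ∑-incident² : ∀ α β u w → ∑ (allFin g) (λ x → 𝟙 (ι α ≈? ι x ℤ.+ u) * 𝟙 (ι β ≈? ι x ℤ.+ w)) ≡
                            𝟙 (ι β ℤ.- ι α ≈? w ℤ.- u)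
  ∑-incident² α β u w = begin
    ∑ (allFin g) (λ x → 𝟙 (ι α ≈? ι x ℤ.+ u) * 𝟙 (ι β ≈? ι x ℤ.+ w))
      ≡⟨ ∑-cong (allFin g) (λ x → cong (_* 𝟙 (ι β ≈? ι x ℤ.+ w)) (𝟙-⇔ (mk⇔ (to (ι x)) (from (ι x))) (ι α ≈? ι x ℤ.+ u) (ι x ≈? z))) ⟩
    ∑ (allFin g) (λ x → 𝟙 (ι x ≈? z) * 𝟙 (ι β ≈? ι x ℤ.+ w))
      ≡⟨ ∑-residue z (λ x → 𝟙 (ι β ≈? ι x ℤ.+ w)) ⟩
    𝟙 (ι β ≈? ι (π z) ℤ.+ w)
      ≡⟨ 𝟙-⇔ (mk⇔ to′ from′) (ι β ≈? ι (π z) ℤ.+ w) (ι β ℤ.- ι α ≈? w ℤ.- u) ⟩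
    𝟙 (ι β ℤ.- ι α ≈? w ℤ.- u) ∎
    where
    open ≡-Reasoning
    z = ι α ℤ.- u
    flip₁ : ∀ a x u → x ℤ.- (a ℤ.- u) ≡ (ℤ.- 1ℤ) ℤ.* (a ℤ.- (x ℤ.+ u)) ℤ.+ 0ℤ
    flip₁ = ℤSolver.solve-∀
    flip₂ : ∀ a x u → a ℤ.- (x ℤ.+ u) ≡ (ℤ.- 1ℤ) ℤ.* (x ℤ.- (a ℤ.- u)) ℤ.+ 0ℤ
    flip₂ = ℤSolver.solve-∀
    to : ∀ x → ι α ≈ x ℤ.+ u → x ≈ z
    to x p = ∣-resp (ℤ.- 1ℤ) 0ℤ (flip₁ (ι α) x u) p (≈-reflexive {0ℤ} refl)
    from : ∀ x → x ≈ z → ι α ≈ x ℤ.+ u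
    from x p = ∣-resp (ℤ.- 1ℤ) 0ℤ (flip₂ (ι α) x u) p (≈-reflexive {0ℤ} refl)
    rearrange : ∀ a b y u w → (b ℤ.- a) ℤ.- (w ℤ.- u) ≡ 1ℤ ℤ.* (b ℤ.- (y ℤ.+ w)) ℤ.+ (y ℤ.- (a ℤ.- u))
    rearrange = ℤSolver.solve-∀
    rearrange′ : ∀ a b y u w → b ℤ.- (y ℤ.+ w) ≡ ℤ.- 1ℤ ℤ.* (y ℤ.- (a ℤ.- u)) ℤ.+ ((b ℤ.- a) ℤ.- (w ℤ.- u))
    rearrange′ = ℤSolver.solve-∀
    to′ : ι β ≈ ι (π z) ℤ.+ w → ι β ℤ.- ι α ≈ w ℤ.- u
    to′ p = ∣-resp 1ℤ (ι (π z) ℤ.- z) (rearrange (ι α) (ι β) (ι (π z)) u w) p (ι-π z)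
    from′ : ι β ℤ.- ι α ≈ w ℤ.- u → ι β ≈ ι (π z) ℤ.+ w
    from′ p = ∣-resp (ℤ.- 1ℤ) ((ι β ℤ.- ι α) ℤ.- (w ℤ.- u)) (rearrange′ (ι α) (ι β) (ι (π z)) u w) (ι-π z) p

  ∑-incident : ∀ α u → ∑ (allFin g) (λ x → 𝟙 (ι α ≈? ι x ℤ.+ u)) ≡ 1
  ∑-incident α u = trans
    (∑-cong (allFin g) (λ x → cong (λ y → 𝟙 (ι α ≈? y ℤ.+ u)) (sym (ℤ.*-identityˡ (ι x)))))
    (∑-linear unit-1 (ι α) u)

  -- Two points ∞ persist in all g translates of a block, whereas a point outside ∞ singles out one
  -- translate.
  scale : Fin 6 → Fin 6 → ℕ
  scale ∞       ∞       = g
  scale ∞       (suc _) = 1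
  scale (suc _) _       = 1

  -- At difference 0 the weight of `atom D 0# 0#` is the number of parameters in `dom D`, which is
  -- the count wanted when ∞ is involved.
  offset : Fin 6 → Fin 6 → Fin g → Fin g → ℤ
  offset (suc _) (suc _) a b = ι b ℤ.- ι a
  offset ∞       _       a b = 0ℤ
  offset (suc _) ∞       a b = 0ℤ

  -- The constant is multiplied by the indicator of the congruence 0 ≈ 0 p + 0 e, true for all
  -- parameters, so that `∑-weight` supplies the size of the domain.
  length-weight : ∀ D c → ∑ (dom D) (λ _ → c) ≡ c * weight 0ℤ (atom D 0# 0#)
  length-weight D c = begin
    ∑ (dom D) (λ _ → c)
      ≡⟨ ∑-cong (dom D) (λ (p , e) → trans (sym (ℕ.*-identityʳ c)) (cong (c *_) (sym (vanishes p e)))) ⟩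
    ∑ (dom D) (λ (p , e) → c * 𝟙 (0ℤ ≈? 0ℤ ℤ.* p ℤ.+ 0ℤ ℤ.* e))
                              ≡⟨ ∑-*ˡ c (dom D) _ ⟨
    c * ∑ (dom D) (λ (p , e) → 𝟙 (0ℤ ≈? 0ℤ ℤ.* p ℤ.+ 0ℤ ℤ.* e))
                              ≡⟨ cong (c *_) (∑-weight D 0# 0# 0ℤ) ⟩
    c * weight 0ℤ (atom D 0# 0#) ∎
    where
    open ≡-Reasoning
    vanishes : ∀ p e → 𝟙 (0ℤ ≈? 0ℤ ℤ.* p ℤ.+ 0ℤ ℤ.* e) ≡ 1
    vanishes p e = 𝟙-yes (0ℤ ≈? 0ℤ ℤ.* p ℤ.+ 0ℤ ℤ.* e)
      (≈-reflexive {0ℤ} (sym (cong₂ ℤ._+_ (ℤ.*-zeroˡ p) (ℤ.*-zeroˡ e))))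

  ∑-pair : ∀ q q′ D k l a b →
    ∑ (dom D) (λ pe → ∑ (allFin g) (λ x → incident q a (ι x ℤ.+ form k pe) * incident q′ b (ι x ℤ.+ form l pe)))
      ≡ scale q q′ * weight (offset q q′ a b) (atomOf q q′ D k l)
  ∑-pair ∞ ∞ D k l a b = trans
    (∑-cong (dom D) (λ _ → trans (∑-allFin-const g 1) (ℕ.*-identityʳ g))) (length-weight D g)
  ∑-pair ∞ (suc _) D k l a b = trans
    (∑-cong (dom D) (λ pe → trans (∑-cong (allFin g) (λ x → ℕ.*-identityˡ _)) (∑-incident b (form l pe))))
    (length-weight D 1)
  ∑-pair (suc _) ∞ D k l a b = trans
    (∑-cong (dom D) (λ pe → trans (∑-cong (allFin g) (λ x → ℕ.*-identityʳ _)) (∑-incident a (form k pe))))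
    (length-weight D 1)
  ∑-pair (suc _) (suc _) D k l a b = trans
    (∑-cong (dom D) (λ pe → trans (∑-incident² a b (form k pe) (form l pe))
      (cong (λ y → 𝟙 (ι b ℤ.- ι a ≈? y)) (form-⊝ k l (proj₁ pe) (proj₂ pe)))))
    (trans (∑-weight D (cᵖ l ⊝ cᵖ k) (cᵉ l ⊝ cᵉ k) (ι b ℤ.- ι a)) (sym (ℕ.*-identityˡ _)))

  -- Pair counts of families in terms of atoms

  Family : Set
  Family = List Param × Template

  joint : List Param → Desc → Desc → Fin V → Fin V → ℕ
  joint ps k l v w = ∑ ps (λ pe → ∑ (allFin g) (λ x →
    𝟙 (v Fin.≟ position (ι x) pe k) * 𝟙 (w Fin.≟ position (ι x) pe l)))

  familyTotal : Fin V → Fin V → Family → ℕ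
  familyTotal v w (ps , t) = ∑ t (λ k → ∑ t (λ l → joint ps k l v w))

  total : List Family → Fin V → Fin V → ℕ
  total Fs v w = ∑ Fs (familyTotal v w)

  withDomain : Dom × Template → Family
  withDomain (D , t) = dom D , t

  joint-weight : ∀ D k l o a o′ b → joint (dom D) k l (point o a) (point o′ b) ≡
    𝟙 (orbit k ≟ₒ o) * (𝟙 (orbit l ≟ₒ o′) *
      (scale (proj₂ o) (proj₂ o′) * weight (offset (proj₂ o) (proj₂ o′) a b) (atomOf (proj₂ o) (proj₂ o′) D k l)))
  joint-weight D k l o@(s , q) a o′@(s′ , q′) b = begin
    joint (dom D) k l (point o a) (point o′ b)
      ≡⟨ ∑-cong (dom D) (λ pe → ∑-cong (allFin g) (λ x → cong₂ _*_
           (𝟙-point o a (orbit k) (ι x ℤ.+ form k pe)) (𝟙-point o′ b (orbit l) (ι x ℤ.+ form l pe)))) ⟩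
    ∑ (dom D) (λ pe → ∑ (allFin g) (λ x → (K * i pe x) * (L * j pe x)))
      ≡⟨ ∑-cong (dom D) (λ pe → trans (∑-cong (allFin g) (λ x → ℕ.[m*n]*[o*p]≡[m*o]*[n*p] K (i pe x) L (j pe x)))
           (sym (∑-*ˡ (K * L) (allFin g) _))) ⟩
    ∑ (dom D) (λ pe → K * L * ∑ (allFin g) (λ x → i pe x * j pe x))
      ≡⟨ ∑-*ˡ (K * L) (dom D) _ ⟨
    K * L * ∑ (dom D) (λ pe → ∑ (allFin g) (λ x → i pe x * j pe x))
      ≡⟨ cong (K * L *_) (∑-pair q q′ D k l a b) ⟩
    K * L * (scale q q′ * weight (offset q q′ a b) (atomOf q q′ D k l))
      ≡⟨ ℕ.*-assoc K L _ ⟩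
    _ ∎
    where
    open ≡-Reasoning
    K = 𝟙 (orbit k ≟ₒ o)
    L = 𝟙 (orbit l ≟ₒ o′)
    i j : Param → Fin g → ℕ
    i pe x = incident q a (ι x ℤ.+ form k pe)
    j pe x = incident q′ b (ι x ℤ.+ form l pe)

  total-weight : ∀ Ts o a o′ b → total (map withDomain Ts) (point o a) (point o′ b) ≡
    scale (proj₂ o) (proj₂ o′) * ∑ (atoms o o′ Ts) (weight (offset (proj₂ o) (proj₂ o′) a b))
  total-weight Ts o@(s , q) a o′@(s′ , q′) b = begin
    total (map withDomain Ts) (point o a) (point o′ b)
      ≡⟨ ∑-map withDomain Ts (familyTotal (point o a) (point o′ b)) ⟩
    ∑ Ts (λ (D , t) → ∑ t (λ k → ∑ t (λ l → joint (dom D) k l (point o a) (point o′ b))))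
      ≡⟨ ∑-cong Ts (λ (D , t) → family D t) ⟩
    ∑ Ts (λ (D , t) → ∑ (on o t) (λ k → ∑ (on o′ t) (λ l → c * W D k l)))
      ≡⟨ ∑-cong Ts (λ (D , t) → trans (∑-cong (on o t) (λ k → sym (∑-*ˡ c (on o′ t) (W D k))))
           (sym (∑-*ˡ c (on o t) _))) ⟩
    ∑ Ts (λ (D , t) → c * ∑ (on o t) (λ k → ∑ (on o′ t) (W D k)))
      ≡⟨ ∑-*ˡ c Ts _ ⟨
    c * ∑ Ts (λ (D , t) → ∑ (on o t) (λ k → ∑ (on o′ t) (W D k)))
      ≡⟨ cong (c *_) (∑-cong Ts (λ (D , t) → trans
           (∑-cong (on o t) (λ k → sym (∑-map (atomOf q q′ D k) (on o′ t) (weight δ))))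
           (sym (∑-concatMap _ (on o t) (weight δ))))) ⟩
    c * ∑ Ts (λ (D , t) → ∑ (concatMap (λ k → map (atomOf q q′ D k) (on o′ t)) (on o t)) (weight δ))
      ≡⟨ cong (c *_) (∑-concatMap _ Ts (weight δ)) ⟨
    c * ∑ (atoms o o′ Ts) (weight δ) ∎
    where
    open ≡-Reasoning
    c = scale q q′
    δ = offset q q′ a b
    W : Dom → Desc → Desc → ℕ
    W D k l = weight δ (atomOf q q′ D k l)
    family : ∀ D t → ∑ t (λ k → ∑ t (λ l → joint (dom D) k l (point o a) (point o′ b))) ≡
                     ∑ (on o t) (λ k → ∑ (on o′ t) (λ l → c * W D k l))
    family D t = begin
      ∑ t (λ k → ∑ t (λ l → joint (dom D) k l (point o a) (point o′ b)))
        ≡⟨ ∑-cong t (λ k → ∑-cong t (λ l → joint-weight D k l o a o′ b)) ⟩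
      ∑ t (λ k → ∑ t (λ l → 𝟙 (orbit k ≟ₒ o) * (𝟙 (orbit l ≟ₒ o′) * (c * W D k l))))
        ≡⟨ ∑-cong t (λ k → ∑-*ˡ (𝟙 (orbit k ≟ₒ o)) t _) ⟨
      ∑ t (λ k → 𝟙 (orbit k ≟ₒ o) * ∑ t (λ l → 𝟙 (orbit l ≟ₒ o′) * (c * W D k l)))
        ≡⟨ ∑-filter (λ d → orbit d ≟ₒ o) t _ ⟨
      ∑ (on o t) (λ k → ∑ t (λ l → 𝟙 (orbit l ≟ₒ o′) * (c * W D k l)))
        ≡⟨ ∑-cong (on o t) (λ k → ∑-filter (λ d → orbit d ≟ₒ o′) t _) ⟨
      ∑ (on o t) (λ k → ∑ (on o′ t) (λ l → c * W D k l)) ∎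

  -- Blocks and the pairs of points they contain

  block : Fin g → Template → Param → Subset V
  block x t pe = fromPoints (map (position (ι x) pe) t)

  familyBlocks : Fin g → Family → List (Subset V)
  familyBlocks x (ps , t) = map (block x t) ps

  translates : List Family → Fin g → List (Subset V)
  translates Fs x = concatMap (familyBlocks x) Fs

  blocks : List Family → List (Subset V)
  blocks Fs = concatMap (translates Fs) (allFin g)

  Distinct : Family → Set
  Distinct (ps , t) = All (λ pe → ∀ x → Unique (map (position (ι x) pe) t)) ps

  All-blocks : ∀ {P : Subset V → Set} Fs →
    All (λ (ps , t) → All (λ pe → ∀ x → P (block x t pe)) ps) Fs → All P (blocks Fs)
  All-blocks Fs ok = concatMap⁺ {φ = translates Fs} {xs = allFin g} (All.tabulate λ {x} _ →
    concatMap⁺ {φ = familyBlocks x} {xs = Fs} (All.map (λ all → All.map⁺ (All.map (λ p → p x) all)) ok))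

  -- As the points of a block are distinct, the product of two membership indicators expands into a
  -- double sum over its points, and the sums over translates and parameters move inside.
  #blocks∋₂-total : ∀ {Fs} → All Distinct Fs → ∀ v w → #blocks∋₂ (blocks Fs) v w ≡ total Fs v w
  #blocks∋₂-total {Fs} distinct v w = begin
    #blocks∋₂ (blocks Fs) v w
      ≡⟨ length-filter both? (blocks Fs) ⟩
    ∑ (blocks Fs) (𝟙 ∘ both?)
      ≡⟨ ∑-concatMap (translates Fs) (allFin g) (𝟙 ∘ both?) ⟩
    ∑ (allFin g) (λ x → ∑ (translates Fs x) (𝟙 ∘ both?))
      ≡⟨ ∑-cong (allFin g) (λ x → trans (∑-concatMap (familyBlocks x) Fs (𝟙 ∘ both?))
           (∑-cong-All (All.map (λ {F} → inBlock x F) distinct))) ⟩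
    ∑ (allFin g) (λ x → ∑ Fs (λ (ps , t) → ∑ ps (λ pe → ∑ t (λ k → ∑ t (λ l → I pe x k l)))))
      ≡⟨ ∑-swap (allFin g) Fs _ ⟩
    ∑ Fs (λ (ps , t) → ∑ (allFin g) (λ x → ∑ ps (λ pe → ∑ t (λ k → ∑ t (λ l → I pe x k l)))))
      ≡⟨ ∑-cong Fs (λ (ps , t) → trans (∑-swap (allFin g) ps _)
           (trans (∑-cong ps (λ pe → ∑-swap₂ (allFin g) t t (I pe)))
                  (∑-swap₂ ps t t (λ pe k l → ∑ (allFin g) (λ x → I pe x k l))))) ⟩
    total Fs v w ∎
    where
    open ≡-Reasoning
    both? : (B : Subset V) → Dec (v ∈ B × w ∈ B)
    both? B = (v ∈? B) ×-dec (w ∈? B)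
    I : Param → Fin g → Desc → Desc → ℕ
    I pe x k l = 𝟙 (v Fin.≟ position (ι x) pe k) * 𝟙 (w Fin.≟ position (ι x) pe l)
    inBlock : ∀ x F → Distinct F → ∑ (map (block x (proj₂ F)) (proj₁ F)) (𝟙 ∘ both?) ≡
              ∑ (proj₁ F) (λ pe → ∑ (proj₂ F) (λ k → ∑ (proj₂ F) (λ l → I pe x k l)))
    inBlock x (ps , t) distinct = trans (∑-map (block x t) ps (𝟙 ∘ both?)) (∑-cong-All (All.map member distinct))
      where
      member : ∀ {pe} → (∀ x → Unique (map (position (ι x) pe) t)) →
            𝟙 (both? (block x t pe)) ≡ ∑ t (λ k → ∑ t (λ l → I pe x k l))
      member {pe} unique = begin
        𝟙 (both? (block x t pe))
          ≡⟨ 𝟙-× (v ∈? block x t pe) (w ∈? block x t pe) ⟩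
        𝟙 (v ∈? block x t pe) * 𝟙 (w ∈? block x t pe)
          ≡⟨ cong₂ _*_ (trans (∈-fromPoints (unique x) v) (∑-map (position (ι x) pe) t _))
                       (trans (∈-fromPoints (unique x) w) (∑-map (position (ι x) pe) t _)) ⟩
        ∑ t (λ k → 𝟙 (v Fin.≟ position (ι x) pe k)) * ∑ t (λ l → 𝟙 (w Fin.≟ position (ι x) pe l))
          ≡⟨ ∑-product t t _ _ ⟩
        ∑ t (λ k → ∑ t (λ l → I pe x k l)) ∎

  -- Makes the replication number a pair count with equal points, covered by the same certificate.
  #blocks∋-diagonal : ∀ Bs (v : Fin V) → #blocks∋ Bs v ≡ #blocks∋₂ Bs v v
  #blocks∋-diagonal Bs v = begin
    #blocks∋ Bs v                                        ≡⟨ length-filter (v ∈?_) Bs ⟩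
    ∑ Bs (λ B → 𝟙 (v ∈? B))
      ≡⟨ ∑-cong Bs (λ B → 𝟙-⇔ (mk⇔ (λ p → p , p) proj₁) (v ∈? B) ((v ∈? B) ×-dec (v ∈? B))) ⟩
    ∑ Bs (λ B → 𝟙 ((v ∈? B) ×-dec (v ∈? B)))             ≡⟨ length-filter (λ B → (v ∈? B) ×-dec (v ∈? B)) Bs ⟨
    #blocks∋₂ Bs v v                                     ∎
    where open ≡-Reasoning

  -- Distinctness of the points of each block

  Positive : Param → Set
  Positive (p , e) = ∃ λ k → p ≡ pos k

  rectangle-positive : ∀ es → All Positive (rectangle es)
  rectangle-positive es = concatMap⁺ {xs = es} (All.tabulate λ _ → All.map⁺ (All.tabulate λ {k} _ → k , refl))

  dom-positive : ∀ D → All (λ pe → constant D ≡ false → Positive pe) (dom D)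
  dom-positive one  = (λ ()) ∷ []
  dom-positive half = All.map (λ p _ → p) (rectangle-positive (zero ∷ []))
  dom-positive full = All.map (λ p _ → p) (rectangle-positive (allFin g))

  nonzero-unit : ∀ c → nonzero c ≡ true → Unit ⟦ c ⟧
  nonzero-unit -2# _ = unit-neg unit-2
  nonzero-unit -1# _ = unit-neg unit-1
  nonzero-unit 1#  _ = unit-1
  nonzero-unit 2#  _ = unit-2

  nonzero-zero : ∀ c → nonzero c ≡ false → c ≡ 0#
  nonzero-zero 0# _ = refl

  pos≉0 : ∀ k → ¬ pos k ≈ 0ℤ
  pos≉0 k e with () ← ≤∧≈⇒≡ {0} {suc (toℕ k)} z≤n (s≤s (ℕ.<-≤-trans (Fin.toℕ<n k) (ℕ.m≤m+n h h))) e

  unit*pos≉0 : ∀ {c} → Unit c → ∀ k e → ¬ c ℤ.* pos k ℤ.+ 0ℤ ℤ.* e ≈ 0ℤ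
  unit*pos≉0 {c} u k e p = pos≉0 k (subst (pos k ≈_) (vanish (Unit.inv u) e)
    (Equivalence.to (solve-unit u 0ℤ (pos k) (0ℤ ℤ.* e)) (≈-sym {c ℤ.* pos k ℤ.+ 0ℤ ℤ.* e} {0ℤ} p)))
    where
    vanish : ∀ i e → i ℤ.* (0ℤ ℤ.- 0ℤ ℤ.* e) ≡ 0ℤ
    vanish = ℤSolver.solve-∀

  -- Within one orbit the coefficients of e agree, so the residues differ by c p with c a unit and p
  -- in 1, ..., h, which is nonzero modulo g.
  apart-position : ∀ {D k l} x pe → Apart D k l → (constant D ≡ false → Positive pe) →
                   position x pe k ≢ position x pe l
  apart-position {k = k} {l} x pe (inj₁ o≢) _ e = o≢ (point-orbit (orbit k) (orbit l) e)
  apart-position {k = desc (s , ∞) _ _} x pe (inj₂ (q≢ , _)) _ e = contradiction refl q≢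
  apart-position {k = k@(desc (s , suc m) _ _)} {l} x pe (inj₂ (_ , D≡ , p≡ , e≡)) positive eq
    with refl ← point-orbit (s , suc m) (orbit l) eq
    with j , refl ← positive D≡
    = unit*pos≉0 (nonzero-unit _ p≡) j e (subst (_≈ 0ℤ)
        (trans (form-⊝ k l (pos j) e) (cong (λ y → ⟦ cᵖ l ⊝ cᵖ k ⟧ ℤ.* pos j ℤ.+ ⟦ y ⟧ ℤ.* e) (nonzero-zero _ e≡)))
        (∣-resp 1ℤ 0ℤ (rearrange x (form l pe) (form k pe)) zl≈zk (≈-reflexive {0ℤ} refl)))
    where
    e = proj₂ pe
    zk = x ℤ.+ form k pe
    zl = x ℤ.+ form l pe
    zl≈zk : zl ≈ zk
    zl≈zk = ≈-trans {zl} {ι (π zl)} {zk} (≈-sym {ι (π zl)} {zl} (ι-π zl))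
      (subst (λ y → ι y ≈ zk) (point-residue s m eq) (ι-π zk))
    rearrange : ∀ x a b → (a ℤ.- b) ℤ.- 0ℤ ≡ 1ℤ ℤ.* ((x ℤ.+ a) ℤ.- (x ℤ.+ b)) ℤ.+ 0ℤ
    rearrange = ℤSolver.solve-∀

  distinct : ∀ D {t} → AllPairs (Apart D) t → ∀ {ps} →
    All (λ pe → constant D ≡ false → Positive pe) ps → Distinct (ps , t)
  distinct D {t} apart = All.map λ {pe} positive x →
    AllPairs.map⁺ (AllPairs.map (λ {k} {l} a → apart-position {D} {k} {l} (ι x) pe a positive) apart)

  -- The actual design and its pair counts

  design : List Family
  design = map withDomain ordinary ++ map (punctured ,_) specials

  Admissible : Family → Set
  Admissible F = Distinct F × Shape (proj₂ F)

  design-families : All Admissible design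
  design-families = All.++⁺
    (All.map⁺ {P = Admissible} {f = withDomain} (All.map ordinary-admissible
      (All.++⁻ˡ ordinary {map (full ,_) specials} wellFormed)))
    (All.map⁺ {P = Admissible} {f = punctured ,_} (All.map special-admissible
      (All.map⁻ {P = WellFormed} {f = full ,_} (All.++⁻ʳ ordinary {map (full ,_) specials} wellFormed))))
    where
    ordinary-admissible : ∀ {T} → WellFormed T → Admissible (withDomain T)
    ordinary-admissible {D , t} (apart , shape) = distinct D apart (dom-positive D) , shape
    special-admissible : ∀ {t} → WellFormed (full , t) → Admissible (punctured , t)
    special-admissible (apart , shape) =
      distinct full apart (All.map (λ p _ → p) (rectangle-positive (tabulate suc))) , shape

  design-distinct : All Distinct design
  design-distinct = All.map proj₁ design-families

  -- By computation `allFin g` is `zero` followed by `tabulate suc`, so `dom full` is the row e = 0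
  -- followed by `punctured`, and `dom half` is that row with an empty tail.
  joint-full : ∀ k l v w → joint punctured k l v w + joint (dom half) k l v w ≡ joint (dom full) k l v w
  joint-full k l v w = begin
    ∑ punctured f + ∑ (dom half) f      ≡⟨ ℕ.+-comm (∑ punctured f) _ ⟩
    ∑ (dom half) f + ∑ punctured f      ≡⟨ cong (λ ps → ∑ ps f + ∑ punctured f) (List.++-identityʳ first) ⟩
    ∑ first f + ∑ punctured f           ≡⟨ ∑-++ first punctured f ⟨
    ∑ (dom full) f                      ∎
    where
    open ≡-Reasoning
    first = map (λ k → pos k , ι zero) (allFin h)
    f : Param → ℕ
    f pe = ∑ (allFin g) (λ x → 𝟙 (v Fin.≟ position (ι x) pe k) * 𝟙 (w Fin.≟ position (ι x) pe l))

  total-++ : ∀ Fs Gs v w → total (Fs ++ Gs) v w ≡ total Fs v w + total Gs v w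
  total-++ Fs Gs v w = ∑-++ Fs Gs (familyTotal v w)

  specials-full : ∀ v w → total (map (punctured ,_) specials) v w + total (map withDomain extra) v w ≡
                          total (map withDomain (map (full ,_) specials)) v w
  specials-full v w = begin
    total (map (punctured ,_) specials) v w + total (map withDomain extra) v w
      ≡⟨ cong₂ _+_ (∑-map (punctured ,_) specials (familyTotal v w))
                   (∑-dom half) ⟩
    ∑ specials (λ t → familyTotal v w (punctured , t)) + ∑ specials (λ t → familyTotal v w (dom half , t))
      ≡⟨ ∑-+ specials (λ t → familyTotal v w (punctured , t)) (λ t → familyTotal v w (dom half , t)) ⟨
    ∑ specials (λ t → familyTotal v w (punctured , t) + familyTotal v w (dom half , t))
      ≡⟨ ∑-cong specials familyTotal-full ⟩
    ∑ specials (λ t → familyTotal v w (dom full , t))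
      ≡⟨ ∑-dom full ⟨
    total (map withDomain (map (full ,_) specials)) v w ∎
    where
    open ≡-Reasoning
    row-total : List Param → Template → Desc → ℕ
    row-total ps t k = ∑ t (λ l → joint ps k l v w)
    ∑-dom : ∀ D → total (map withDomain (map (D ,_) specials)) v w ≡ ∑ specials (λ t → familyTotal v w (dom D , t))
    ∑-dom D = trans (∑-map withDomain (map (D ,_) specials) (familyTotal v w))
                    (∑-map (D ,_) specials (λ T → familyTotal v w (withDomain T)))
    familyTotal-full : ∀ t → familyTotal v w (punctured , t) + familyTotal v w (dom half , t) ≡ familyTotal v w (dom full , t)
    familyTotal-full t = begin
      ∑ t (row-total punctured t) + ∑ t (row-total (dom half) t)
        ≡⟨ ∑-+ t (row-total punctured t) (row-total (dom half) t) ⟨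
      ∑ t (λ k → row-total punctured t k + row-total (dom half) t k)
        ≡⟨ ∑-cong t (λ k → trans (sym (∑-+ t (λ l → joint punctured k l v w) (λ l → joint (dom half) k l v w)))
             (∑-cong t (λ l → joint-full k l v w))) ⟩
      ∑ t (row-total (dom full) t) ∎

  total-design : ∀ v w → total design v w + total (map withDomain extra) v w ≡ total (map withDomain virtual) v w
  total-design v w = begin
    total design v w + E
      ≡⟨ cong (λ y → y + E) (total-++ (map withDomain ordinary) (map (punctured ,_) specials) v w) ⟩
    total (map withDomain ordinary) v w + total (map (punctured ,_) specials) v w + E
      ≡⟨ ℕ.+-assoc (total (map withDomain ordinary) v w) _ E ⟩
    total (map withDomain ordinary) v w + (total (map (punctured ,_) specials) v w + E)
      ≡⟨ cong (λ y → total (map withDomain ordinary) v w + y) (specials-full v w) ⟩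
    total (map withDomain ordinary) v w + total (map withDomain (map (full ,_) specials)) v w
      ≡⟨ total-++ (map withDomain ordinary) (map withDomain (map (full ,_) specials)) v w ⟨
    total (map withDomain ordinary ++ map withDomain (map (full ,_) specials)) v w
      ≡⟨ cong (λ Fs → total Fs v w) (List.map-++ withDomain ordinary (map (full ,_) specials)) ⟨
    total (map withDomain virtual) v w ∎
    where
    open ≡-Reasoning
    E = total (map withDomain extra) v w

  module _ (s : Fin 2) (q : Fin 6) (a : Fin g) (s′ : Fin 2) (q′ : Fin 6) (b : Fin g) where
    private
      o o′ : Orbit
      o  = s , q
      o′ = s′ , q′
      c = scale q q′
      δ = offset q q′ a b
      v = point o a
      w = point o′ b

    -- The count for `extra` is added to both sides and cancelled, which avoids subtraction in ℕ.
    -- `F` stands for `generic` or `coincident`.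
    #blocks∋₂-design : ∀ (F : Vec ℕ 12 → Poly) T →
      (∀ Ts → Balanced (tally (atoms o o′ Ts)) →
        dot (tally (atoms o o′ Ts)) (weights δ) ≡ ⟪ F (tally (atoms o o′ Ts)) ⟫) →
      F (tally (atoms o o′ virtual)) ≡ F (tally (atoms o o′ extra)) ⊞ T →
      #blocks∋₂ (blocks design) v w ≡ c * ⟪ T ⟫
    #blocks∋₂-design F T evaluate F≡ = ℕ.+-cancelʳ-≡ (c * ⟪ F m ⟫) _ _ (begin
      #blocks∋₂ (blocks design) v w + c * ⟪ F m ⟫
        ≡⟨ cong₂ _+_ (#blocks∋₂-total design-distinct v w) (sym (weigh extra (proj₁ (proj₂ cert)))) ⟩
      total design v w + total (map withDomain extra) v w    ≡⟨ total-design v w ⟩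
      total (map withDomain virtual) v w                     ≡⟨ weigh virtual (proj₁ cert) ⟩
      c * ⟪ F (tally (atoms o o′ virtual)) ⟫                 ≡⟨ cong (λ P → c * ⟪ P ⟫) F≡ ⟩
      c * ⟪ F m ⊞ T ⟫                                        ≡⟨ cong (c *_) (⟪⟫-⊞ (F m) T) ⟩
      c * (⟪ F m ⟫ + ⟪ T ⟫)                                  ≡⟨ ℕ.*-distribˡ-+ c ⟪ F m ⟫ ⟪ T ⟫ ⟩
      c * ⟪ F m ⟫ + c * ⟪ T ⟫                                ≡⟨ ℕ.+-comm (c * ⟪ F m ⟫) _ ⟩
      c * ⟪ T ⟫ + c * ⟪ F m ⟫                                ∎)
      where
      open ≡-Reasoning
      cert = certificate s q s′ q′
      m = tally (atoms o o′ extra)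
      weigh : ∀ Ts → Balanced (tally (atoms o o′ Ts)) →
              total (map withDomain Ts) v w ≡ c * ⟪ F (tally (atoms o o′ Ts)) ⟫
      weigh Ts balanced = trans (total-weight Ts o a o′ b)
        (cong (c *_) (trans (∑-tally (atoms o o′ Ts) δ) (evaluate Ts balanced)))

    pair-generic : ¬ δ ≈ 0ℤ → #blocks∋₂ (blocks design) v w ≡ c * ⟪ genericTarget o o′ ⟫
    pair-generic δ≉0 = #blocks∋₂-design generic (genericTarget o o′)
      (λ Ts balanced → dot-generic (tally (atoms o o′ Ts)) δ balanced δ≉0)
      (proj₁ (proj₂ (proj₂ (certificate s q s′ q′))))

    pair-coincident : δ ≈ 0ℤ → #blocks∋₂ (blocks design) v w ≡ c * ⟪ coincidentTarget o o′ ⟫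
    pair-coincident δ≈0 = #blocks∋₂-design coincident (coincidentTarget o o′)
      (λ Ts _ → dot-coincident (tally (atoms o o′ Ts)) δ δ≈0)
      (proj₂ (proj₂ (proj₂ (certificate s q s′ q′))))

  -- The design

  λ₁ λ₂ : ℕ
  λ₁ = 2 * n
  λ₂ = n ∸ 1

  -- The left sides here and below are `scale` times an evaluated target exactly as it unfolds,
  -- hence the factors 1 and the zero coefficients.
  same≡ : 1 * (12 + 20 * h + 0 * (g * h)) ≡ λ₁
  same≡ = lemma h
    where
    lemma : ∀ h → 1 * (12 + 20 * h + 0 * ((1 + (h + h)) * h)) ≡ 2 * (1 + 5 * (1 + (h + h)))
    lemma = solve-∀

  different≡ : 1 * (5 + 10 * h + 0 * (g * h)) ≡ λ₂
  different≡ = lemma h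
    where
    lemma : ∀ h → 1 * (5 + 10 * h + 0 * ((1 + (h + h)) * h)) ≡ 5 * (1 + (h + h))
    lemma = solve-∀

  different∞≡ : g * (5 + 0 * h + 0 * (g * h)) ≡ λ₂
  different∞≡ = lemma h
    where
    lemma : ∀ h → (1 + (h + h)) * (5 + 0 * h + 0 * ((1 + (h + h)) * h)) ≡ 5 * (1 + (h + h))
    lemma = solve-∀

  replication≡ : 1 * (18 + 36 * h + 30 * (g * h)) ≡ g * (18 + 30 * h + 0 * (g * h))
  replication≡ = lemma h
    where
    lemma : ∀ h → 1 * (18 + 36 * h + 30 * ((1 + (h + h)) * h)) ≡
                  (1 + (h + h)) * (18 + 30 * h + 0 * ((1 + (h + h)) * h))
    lemma = solve-∀

  difference≈0 : ∀ {a b} → ι b ℤ.- ι a ≈ 0ℤ → a ≡ b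
  difference≈0 {a} {b} p = sym (ι-injective (subst (+ g ∣_) (ℤ.+-identityʳ _) p))

  -- This is 3 n g, in the form in which the count at ∞ delivers it.
  r : ℕ
  r = g * (18 + 30 * h + 0 * (g * h))

  0≈0 : 0ℤ ≈ 0ℤ
  0≈0 = ≈-reflexive {0ℤ} refl

  diagonal : ∀ s q a → #blocks∋₂ (blocks design) (point (s , q) a) (point (s , q) a) ≡ r
  diagonal s ∞ a = trans (pair-coincident s ∞ a s ∞ a 0≈0)
    -- With `s` a variable the comparison of sides inside the target does not reduce, so its Boolean
    -- value is substituted.
    (cong (λ B → g * ⟪ if B then poly 18 30 0 else poly 5 0 0 ⟫) (dec-true (s Fin.≟ s) refl))
  diagonal s q@(suc _) a = trans (pair-coincident s q a s q a (≈-reflexive (ℤ.+-inverseʳ (ι a))))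
    (trans (cong₂ (λ B C → 1 * ⟪ if B then (if C then poly 18 36 30 else poly 12 20 0) else poly 5 10 0 ⟫)
      (dec-true (s Fin.≟ s) refl) (dec-true (q Fin.≟ q) refl)) replication≡)

  equal-sides : ∀ s q a q′ b → point (s , q) a ≢ point (s , q′) b →
                #blocks∋₂ (blocks design) (point (s , q) a) (point (s , q′) b) ≡ λ₁
  equal-sides s ∞ a ∞ b v≢w = contradiction refl v≢w
  equal-sides s ∞ a q′@(suc _) b v≢w = trans (pair-coincident s ∞ a s q′ b 0≈0)
    (trans (cong (λ B → 1 * ⟪ if B then poly 12 20 0 else poly 5 10 0 ⟫) (dec-true (s Fin.≟ s) refl)) same≡)
  equal-sides s q@(suc _) a ∞ b v≢w = trans (pair-coincident s q a s ∞ b 0≈0)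
    (trans (cong (λ B → 1 * ⟪ if B then poly 12 20 0 else poly 5 10 0 ⟫) (dec-true (s Fin.≟ s) refl)) same≡)
  equal-sides s q@(suc _) a q′@(suc _) b v≢w = [ met , apart ]′ (toSum (ι b ℤ.- ι a ≈? 0ℤ))
    where
    -- Equal residues force different labels, which keeps this case off the diagonal, where the
    -- target is r.
    q≢q′ : ι b ℤ.- ι a ≈ 0ℤ → q ≢ q′
    q≢q′ δ≈0 refl = v≢w (cong (point (s , q)) (difference≈0 δ≈0))
    apart : ¬ ι b ℤ.- ι a ≈ 0ℤ → #blocks∋₂ (blocks design) (point (s , q) a) (point (s , q′) b) ≡ λ₁
    apart δ≉0 = trans (pair-generic s q a s q′ b δ≉0)
      (trans (cong (λ B → 1 * ⟪ if B then poly 12 20 0 else poly 5 10 0 ⟫) (dec-true (s Fin.≟ s) refl)) same≡)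
    met : ι b ℤ.- ι a ≈ 0ℤ → #blocks∋₂ (blocks design) (point (s , q) a) (point (s , q′) b) ≡ λ₁
    met δ≈0 = trans (pair-coincident s q a s q′ b δ≈0)
      (trans (cong₂ (λ B C → 1 * ⟪ if B then (if C then poly 18 36 30 else poly 12 20 0) else poly 5 10 0 ⟫)
        (dec-true (s Fin.≟ s) refl) (dec-false (q Fin.≟ q′) (q≢q′ δ≈0))) same≡)

  different-sides : ∀ s q a s′ q′ b → s ≢ s′ →
                    #blocks∋₂ (blocks design) (point (s , q) a) (point (s′ , q′) b) ≡ λ₂
  different-sides s ∞ a s′ ∞ b s≢s′ = trans (pair-coincident s ∞ a s′ ∞ b 0≈0)
    (trans (cong (λ B → g * ⟪ if B then poly 18 30 0 else poly 5 0 0 ⟫) (dec-false (s Fin.≟ s′) s≢s′)) different∞≡)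
  different-sides s ∞ a s′ q′@(suc _) b s≢s′ = trans (pair-coincident s ∞ a s′ q′ b 0≈0)
    (trans (cong (λ B → 1 * ⟪ if B then poly 12 20 0 else poly 5 10 0 ⟫) (dec-false (s Fin.≟ s′) s≢s′)) different≡)
  different-sides s q@(suc _) a s′ ∞ b s≢s′ = trans (pair-coincident s q a s′ ∞ b 0≈0)
    (trans (cong (λ B → 1 * ⟪ if B then poly 12 20 0 else poly 5 10 0 ⟫) (dec-false (s Fin.≟ s′) s≢s′)) different≡)
  different-sides s q@(suc _) a s′ q′@(suc _) b s≢s′ = [ met , apart ]′ (toSum (ι b ℤ.- ι a ≈? 0ℤ))
    where
    apart : ¬ ι b ℤ.- ι a ≈ 0ℤ → #blocks∋₂ (blocks design) (point (s , q) a) (point (s′ , q′) b) ≡ λ₂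
    apart δ≉0 = trans (pair-generic s q a s′ q′ b δ≉0)
      (trans (cong (λ B → 1 * ⟪ if B then poly 12 20 0 else poly 5 10 0 ⟫) (dec-false (s Fin.≟ s′) s≢s′)) different≡)
    met : ι b ℤ.- ι a ≈ 0ℤ → #blocks∋₂ (blocks design) (point (s , q) a) (point (s′ , q′) b) ≡ λ₂
    met δ≈0 = trans (pair-coincident s q a s′ q′ b δ≈0)
      (trans (cong (λ B → 1 * ⟪ if B then (if does (q Fin.≟ q′) then poly 18 36 30 else poly 12 20 0) else poly 5 10 0 ⟫)
        (dec-false (s Fin.≟ s′) s≢s′)) different≡)

  point-elim : ∀ (P : Fin V → Set) → (∀ o a → P (point o a)) → ∀ x → P x
  point-elim P p x = let o , a , e = point-surjective x in subst P e (p o a)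

  group-point : ∀ {i} o a → point o a ∈ parts n i → proj₁ o ≡ i
  group-point {i} o a x∈ = trans (sym (part-point o a)) (Equivalence.to (∈-parts n (point o a) i) x∈)

  D : GDD n 2 6 λ₁ λ₂
  D = record
    { group           = parts n
    ; group-partition = λ x → part n x , Equivalence.from (∈-parts n x _) refl , Equivalence.to (∈-parts n x _)
    ; group-size      = ∣parts∣ n
    ; blocks          = blocks design
    ; block-size      = All-blocks design (All.map sizes design-families)
    ; r               = r
    ; replication     = replicated
    ; same-group      = same
    ; different-group = different
    }
    where
    sizes : ∀ {F} → Admissible F → All (λ pe → ∀ x → ∣ block x (proj₂ F) pe ∣ ≡ 6) (proj₁ F)
    sizes {ps , t} (distinct , size , _) = All.map (λ {pe} unique x → trans (∣fromPoints∣ (unique x))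
      (trans (List.length-map (position (ι x) pe) t) size)) distinct
    replicated : ∀ x → #blocks∋ (blocks design) x ≡ r
    replicated = point-elim _ λ (s , q) a → trans (#blocks∋-diagonal (blocks design) (point (s , q) a)) (diagonal s q a)
    same : ∀ i {x y} → x ∈ parts n i → y ∈ parts n i → x ≢ y → #blocks∋₂ (blocks design) x y ≡ λ₁
    same i {x} {y} = point-elim
      (λ x → x ∈ parts n i → y ∈ parts n i → x ≢ y → #blocks∋₂ (blocks design) x y ≡ λ₁)
      (λ o a → point-elim
        (λ y → point o a ∈ parts n i → y ∈ parts n i → point o a ≢ y → #blocks∋₂ (blocks design) (point o a) y ≡ λ₁)
        (λ o′ b x∈ y∈ → on-sides o a o′ b (trans (group-point o a x∈) (sym (group-point o′ b y∈)))) y) x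
      where
      on-sides : ∀ o a o′ b → proj₁ o ≡ proj₁ o′ → point o a ≢ point o′ b →
                 #blocks∋₂ (blocks design) (point o a) (point o′ b) ≡ λ₁
      on-sides (s , q) a (.s , q′) b refl = equal-sides s q a q′ b
    different : ∀ {i j} → i ≢ j → ∀ {x y} → x ∈ parts n i → y ∈ parts n j → #blocks∋₂ (blocks design) x y ≡ λ₂
    different {i} {j} i≢j {x} {y} = point-elim
      (λ x → x ∈ parts n i → y ∈ parts n j → #blocks∋₂ (blocks design) x y ≡ λ₂)
      (λ (s , q) a → point-elim
        (λ y → point (s , q) a ∈ parts n i → y ∈ parts n j →
                #blocks∋₂ (blocks design) (point (s , q) a) y ≡ λ₂)
        (λ (s′ , q′) b x∈ y∈ → different-sides s q a s′ q′ b
          (λ s≡s′ → i≢j (trans (sym (group-point (s , q) a x∈)) (trans s≡s′ (group-point (s′ , q′) b y∈))))) y) x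

  -- The configuration (1,5)

  opposite-≢ : ∀ (i : Fin 2) → i ≢ Fin.opposite i
  opposite-≢ 0F ()
  opposite-≢ 1F ()

  ∣block∩group∣ : ∀ {x t pe} → Unique (map (position (ι x) pe) t) → ∀ i → ∣ block x t pe ∩ parts n i ∣ ≡ #side t i
  ∣block∩group∣ {x} {t} {pe} unique i = begin
    ∣ block x t pe ∩ parts n i ∣                                        ≡⟨ ∣fromPoints-∩∣ unique (parts n i) ⟩
    ∑ (map (position (ι x) pe) t) (λ u → 𝟙 (u ∈? parts n i))            ≡⟨ ∑-map (position (ι x) pe) t _ ⟩
    ∑ t (λ d → 𝟙 (position (ι x) pe d ∈? parts n i))
      ≡⟨ ∑-cong t (λ d → trans (𝟙-parts n (position (ι x) pe d) i)
                                                                             (cong (λ j → 𝟙 (j Fin.≟ i)) (part-point (orbit d) _))) ⟩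
    #side t i                                                           ∎
    where open ≡-Reasoning

  configuration : HasConfiguration 1 5 D
  configuration = All-blocks design (All.map (λ (distinct , _ , i , single , five) → All.map (λ unique x →
    i , Fin.opposite i , opposite-≢ i , trans (∣block∩group∣ (unique x) i) single ,
    trans (∣block∩group∣ (unique x) (Fin.opposite i)) five) distinct) design-families)

theorem7p4 : (n : ℕ) → 0 < n → n % 10 ≡ 6 →
    Σ (GDD n 2 6 (2 * n) (n ∸ 1)) (HasConfiguration 1 5)
theorem7p4 n _ n%10≡6 = subst (λ n → Σ (GDD n 2 6 (2 * n) (n ∸ 1)) (HasConfiguration 1 5)) (sym n≡)
  (Construction.D (n / 10) , Construction.configuration (n / 10))
  where
  -- For n = 10 h + 6 the parameter h is the quotient `n / 10`.
  decimal : ∀ h → 6 + h * 10 ≡ 1 + 5 * (1 + (h + h))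
  decimal = solve-∀
  n≡ : n ≡ 1 + 5 * (1 + (n / 10 + n / 10))
  n≡ = trans (m≡m%n+[m/n]*n n 10) (trans (cong (λ y → y + n / 10 * 10) n%10≡6) (decimal (n / 10)))
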